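{- Let $G$ be a chordal graph and let $B$ be an induced complete bipartite subgraph of $G$ with bipartition sets $B_X=\{x\}$ and $B_Y=\{y_1,\dots,y_k\}$, $k \ge 1$. For each connected component $C$ of $G[M_2(B)]$ choose any vertex $w_C \in V(C)$ such that $|f(w_C)| = \max\{|f(w)| : w \in V(C)\}$, and let $S$ be the set of all the chosen vertices $w_C$. Then $B$ is a generating subgraph of $G$ if and only if $S$ dominates $M_1(B)$. Moreover, the algorithm that computes $M_1(B)$, $M_2(B)$, the connected components of $G[M_2(B)]$, the values $|f(w)|$ for $w\in M_2(B)$, such a set $S$, and then answers "generating" if $S$ dominates $M_1(B)$ and "not generating" otherwise, can be implemented in $O(|V(G)|^2)$ time.
   Context: All graphs are finite, simple and undirected. A graph is chordal if every induced cycle is a triangle. For a non-empty set $S$ of vertices and a vertex $u$, $d(u,S)=\min\{d(u,s): s\in S\}$, where $d$ is the graph distance; $N_i(S)=\{v\in V(G): d(v,S)=i\}$, $N_i[S]=\{v \in V(G): d(v,S)\le i\}$ for positive integers $i$, with $N_i(\emptyset)=N_i[\emptyset]=\emptyset$; $N_i(v)=N_i(\{v\})$. $G[S]$ is the subgraph induced by $S$. A set $S$ of vertices dominates a set $T$ of vertices if $T\subseteq N_1[S]$. Let $B$ be an induced complete bipartite subgraph with bipartition sets $B_X$ and $B_Y$. $B$ is generating if there exists an independent set $S$ of $G$ such that each of $S\cup B_X$ and $S\cup B_Y$ is a maximal (with respect to inclusion) independent set of $G$. For $\{U,V\}=\{X,Y\}$ and non-empty $S\subseteq B_V$ put $M_1(S)=N_1(S)\cap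 N_2(B_U)$ and $M_2(S)=N_1(M_1(S))\cap N_2(B_V)$. Put $M_1(B)=M_1(B_X)\cup M_1(B_Y)$ and $M_2(B)=M_2(B_X)\cup M_2(B_Y)$. For $w\in M_2(B)$, $f(w)=N_1(w)\cap M_1(B)$. -}

module Defs where

open import Data.Bool using (Bool; true; false; T; if_then_else_)
open import Data.Bool.Properties using (T?)
open import Data.Fin as Fin using (Fin; toℕ)
open import Data.Fin.Properties using (any?; all?)
open import Data.Fin.Subset using (Subset; _∈_; _⊆_; _∩_; _∪_; ⁅_⁆; Nonempty; ∣_∣)
open import Data.Fin.Subset.Properties using (_∈?_)
open import Data.Nat using (ℕ; zero; suc; _+_; _*_; _∸_; _≤_; _<_; _≡ᵇ_)
open import Data.Nat.Properties using (allUpTo?; anyUpTo?)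
open import Data.Product using (∃-syntax; _×_)
open import Data.Sum using (_⊎_)
open import Data.Vec using (lookup; tabulate)
open import Function using (_∘_; _⇔_)
open import Function.Definitions using (Injective)
open import Relation.Binary.Construct.Closure.ReflexiveTransitive using (Star)
open import Relation.Binary.PropositionalEquality using (_≡_; _≢_)
open import Relation.Nullary using (¬_; Dec; does; ¬?; _×-dec_; _→-dec_)
open import Relation.Unary using (Pred; Decidable)

------------------------------------------------------------------------
-- Graphs

record Graph (n : ℕ) : Set where
  field
    adj     : Fin n → Fin n → Bool
    adj-sym : ∀ u v → adj u v ≡ adj v u
    no-loop : ∀ v → adj v v ≡ false

  Adj : Fin n → Fin n → Set
  Adj u v = T (adj u v)

toSubset : ∀ {n ℓ} {P : Pred (Fin n) ℓ} → Decidable P → Subset n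
toSubset P? = tabulate (does ∘ P?)

-- i and j are neighbours on the cycle 0, 1, …, m − 1, 0.
CyclicNeighbours : ∀ {m} → Fin m → Fin m → Set
CyclicNeighbours {m} i j = Next i j ⊎ Next j i
  where
  Next : Fin m → Fin m → Set
  Next a b = toℕ b ≡ suc (toℕ a) ⊎ (toℕ b ≡ 0 × suc (toℕ a) ≡ m)

module _ {n : ℕ} (G : Graph n) where
  open Graph G

  record InducedCycle (m : ℕ) : Set where
    field
      3≤m       : 3 ≤ m
      vertex    : Fin m → Fin n
      injective : Injective _≡_ _≡_ vertex
      induced   : ∀ i j → Adj (vertex i) (vertex j) ⇔ CyclicNeighbours i j

  Chordal : Set
  Chordal = ∀ m → InducedCycle m → m ≡ 3

  Walk : ℕ → Fin n → Fin n → Set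
  Walk zero    u v = u ≡ v
  Walk (suc k) u v = ∃[ w ] Adj u w × Walk k w v

  -- d(u,v) = k.  The relation has no k when u and v lie in different
  -- components (infinite distance).
  Distance : Fin n → Fin n → ℕ → Set
  Distance u v k = Walk k u v × (∀ {j} → j < k → ¬ Walk j u v)

  -- d(u,S) = k, the minimum of d(u,s) over s ∈ S.  It never holds for
  -- S = ∅, which gives N_i(∅) = N_i[∅] = ∅ below.
  SetDistance : Fin n → Subset n → ℕ → Set
  SetDistance u S k =
    (∃[ s ] s ∈ S × Distance u s k) ×
    (∀ s → s ∈ S → ∀ {j} → j < k → ¬ Distance u s j)

  walk? : ∀ k u v → Dec (Walk k u v)
  walk? zero    u v = u Fin.≟ v
  walk? (suc k) u v = any? λ w → T? (adj u w) ×-dec walk? k w v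

  distance? : ∀ u v k → Dec (Distance u v k)
  distance? u v k = walk? k u v ×-dec allUpTo? (λ j → ¬? (walk? j u v)) k

  setDistance? : ∀ u S k → Dec (SetDistance u S k)
  setDistance? u S k =
    any? (λ s → (s ∈? S) ×-dec distance? u s k) ×-dec
    all? (λ s → (s ∈? S) →-dec allUpTo? (λ j → ¬? (distance? u s j)) k)

  -- N i S is N_i(S), and N≤ i S is N_i[S].
  N : ℕ → Subset n → Subset n
  N i S = toSubset (λ v → setDistance? v S i)

  N≤ : ℕ → Subset n → Subset n
  N≤ i S = toSubset (λ v → anyUpTo? (setDistance? v S) (suc i))

  Dominates : Subset n → Subset n → Set
  Dominates S U = U ⊆ N≤ 1 S

  Independent : Subset n → Set
  Independent S = ∀ {u v} → u ∈ S → v ∈ S → ¬ Adj u v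

  MaximalIndependent : Subset n → Set
  MaximalIndependent S =
    Independent S × (∀ S′ → Independent S′ → S ⊆ S′ → S′ ⊆ S)

  -- Disjointness of the two sides follows from the absence of loops.
  record InducedCompleteBipartite (BX BY : Subset n) : Set where
    field
      nonemptyX    : Nonempty BX
      nonemptyY    : Nonempty BY
      independentX : Independent BX
      independentY : Independent BY
      complete     : ∀ {x y} → x ∈ BX → y ∈ BY → Adj x y

  Generating : Subset n → Subset n → Set
  Generating BX BY =
    ∃[ S ] Independent S ×
      MaximalIndependent (S ∪ BX) × MaximalIndependent (S ∪ BY)

  -- M_1(S) and M_2(S) for S ⊆ B_V, where {U,V} = {X,Y}.
  M₁-of : (BU S : Subset n) → Subset n
  M₁-of BU S = N 1 S ∩ N 2 BU

  M₂-of : (BU BV S : Subset n) → Subset n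
  M₂-of BU BV S = N 1 (M₁-of BU S) ∩ N 2 BV

  M₁ M₂ : (BX BY : Subset n) → Subset n
  M₁ BX BY = M₁-of BY BX ∪ M₁-of BX BY
  M₂ BX BY = M₂-of BY BX BX ∪ M₂-of BX BY BY

  f : (BX BY : Subset n) → Fin n → Subset n
  f BX BY w = N 1 ⁅ w ⁆ ∩ M₁ BX BY

  -- Reachability in G[U], for vertices of U.
  Reachable : Subset n → Fin n → Fin n → Set
  Reachable U = Star (λ u v → u ∈ U × v ∈ U × Adj u v)

  -- C is the vertex set of a connected component of G[U].
  record IsComponent (U C : Subset n) : Set where
    field
      nonempty  : Nonempty C
      contained : C ⊆ U
      connected : ∀ {u v} → u ∈ C → v ∈ C → Reachable U u v
      closed    : ∀ {u v} → u ∈ C → Reachable U u v → v ∈ C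

  -- S arises by choosing, in each component C of G[M₂(B)], a vertex w C
  -- maximising |f|.  The value of w on other sets is irrelevant.
  record ChosenBy (BX BY : Subset n) (w : Subset n → Fin n) (S : Subset n) : Set where
    field
      chosen  : ∀ C → IsComponent (M₂ BX BY) C → w C ∈ C
      maximal : ∀ C → IsComponent (M₂ BX BY) C →
                ∀ v → v ∈ C → ∣ f BX BY v ∣ ≤ ∣ f BX BY (w C) ∣
      image   : ∀ v → v ∈ S ⇔ (∃[ C ] IsComponent (M₂ BX BY) C × v ≡ w C)

------------------------------------------------------------------------
-- A random access machine under the uniform cost criterion, with
-- structured control flow.  A program mentions finitely many registers
-- and arrays.  Addition and truncated subtraction are the only arithmetic
-- operations: unit-cost multiplication would make the model unreasonably
-- strong.

data Expr : Set where
  lit     : ℕ → Expr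
  var     : ℕ → Expr
  get     : ℕ → Expr → Expr
  _⊕_ _⊖_ : Expr → Expr → Expr

-- Tests succeed on nonzero values.
data Cmd : Set where
  _≔_   : ℕ → Expr → Cmd
  put   : ℕ → Expr → Expr → Cmd
  _⨾_   : Cmd → Cmd → Cmd
  ifnz  : Expr → Cmd → Cmd → Cmd
  while : Expr → Cmd → Cmd

infixl 6 _⊕_ _⊖_
infix  5 _≔_
infixr 4 _⨾_

record State : Set where
  constructor state
  field
    reg : ℕ → ℕ
    arr : ℕ → ℕ → ℕ
open State public

update : ∀ {A : Set} → (ℕ → A) → ℕ → A → ℕ → A
update g i a j = if i ≡ᵇ j then a else g j

⟦_⟧ : Expr → State → ℕ
⟦ lit k   ⟧ σ = k
⟦ var r   ⟧ σ = reg σ r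
⟦ get a e ⟧ σ = arr σ a (⟦ e ⟧ σ)
⟦ d ⊕ e   ⟧ σ = ⟦ d ⟧ σ + ⟦ e ⟧ σ
⟦ d ⊖ e   ⟧ σ = ⟦ d ⟧ σ ∸ ⟦ e ⟧ σ

-- c ⊢ σ ⇓ τ [ t ]: started in σ, c halts in τ at cost t.  Each assignment
-- and each test costs 1; the expressions of a fixed program have bounded
-- size, so their evaluation only contributes a constant factor.
infix 3 _⊢_⇓_[_]
data _⊢_⇓_[_] : Cmd → State → State → ℕ → Set where
  assign  : ∀ {r e σ} →
            r ≔ e ⊢ σ ⇓ state (update (reg σ) r (⟦ e ⟧ σ)) (arr σ) [ 1 ]
  store   : ∀ {a i e σ} →
            put a i e ⊢ σ ⇓
            state (reg σ) (update (arr σ) a (update (arr σ a) (⟦ i ⟧ σ) (⟦ e ⟧ σ))) [ 1 ]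
  seq     : ∀ {c d σ τ υ s t} →
            c ⊢ σ ⇓ τ [ s ] → d ⊢ τ ⇓ υ [ t ] → c ⨾ d ⊢ σ ⇓ υ [ s + t ]
  if-yes  : ∀ {e c d σ τ t} → ⟦ e ⟧ σ ≢ 0 →
            c ⊢ σ ⇓ τ [ t ] → ifnz e c d ⊢ σ ⇓ τ [ suc t ]
  if-no   : ∀ {e c d σ τ t} → ⟦ e ⟧ σ ≡ 0 →
            d ⊢ σ ⇓ τ [ t ] → ifnz e c d ⊢ σ ⇓ τ [ suc t ]
  loop    : ∀ {e c σ τ υ s t} → ⟦ e ⟧ σ ≢ 0 →
            c ⊢ σ ⇓ τ [ s ] → while e c ⊢ τ ⇓ υ [ t ] →
            while e c ⊢ σ ⇓ υ [ suc (s + t) ]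
  exit    : ∀ {e c σ} → ⟦ e ⟧ σ ≡ 0 →
            while e c ⊢ σ ⇓ σ [ 1 ]

------------------------------------------------------------------------
-- Input and output conventions

bit : Bool → ℕ
bit b = if b then 1 else 0

-- The array a holds the characteristic vector of S.
Holds : ∀ {n} → State → ℕ → Subset n → Set
Holds σ a S = ∀ v → arr σ a (toℕ v) ≡ bit (lookup S v)

-- The graph is given by its adjacency matrix, stored row by row.  All
-- other registers and cells of the initial state are arbitrary.
record Input {n} (G : Graph n) (x : Fin n) (BY : Subset n) (σ : State) : Set where
  field
    order  : reg σ 0 ≡ n
    centre : reg σ 1 ≡ toℕ x
    matrix : ∀ u v → arr σ 0 (toℕ u * n + toℕ v) ≡ bit (Graph.adj G u v)
    leaves : Holds σ 1 BY

-- The final state holds M₁(B), M₂(B), labels for the components of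
-- G[M₂(B)], the values |f(w)|, a set S as in ChosenBy, and the answer
-- (1 for "generating", 0 for "not generating").
record Output {n} (G : Graph n) (BX BY : Subset n) (τ : State) : Set where
  field
    M₁-array   : Holds τ 2 (M₁ G BX BY)
    M₂-array   : Holds τ 3 (M₂ G BX BY)
    components : ∀ u v → u ∈ M₂ G BX BY → v ∈ M₂ G BX BY →
                 arr τ 4 (toℕ u) ≡ arr τ 4 (toℕ v) ⇔
                 (∃[ C ] IsComponent G (M₂ G BX BY) C × u ∈ C × v ∈ C)
    f-sizes    : ∀ w → w ∈ M₂ G BX BY → arr τ 5 (toℕ w) ≡ ∣ f G BX BY w ∣
    w          : Subset n → Fin n
    S          : Subset n
    S-chosen   : ChosenBy G BX BY w S
    S-array    : Holds τ 6 S
    answer-yes : Dominates G S (M₁ G BX BY) → reg τ 2 ≡ 1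
    answer-no  : ¬ Dominates G S (M₁ G BX BY) → reg τ 2 ≡ 0

-- On the graphs and subgraphs considered, c computes its output within
-- O(|V(G)|²) steps.
RunsInQuadraticTime : Cmd → Set
RunsInQuadraticTime c =
  ∃[ K ] (∀ {n} (G : Graph n) → Chordal G →
    ∀ x BY → InducedCompleteBipartite G ⁅ x ⁆ BY →
    ∀ σ → Input G x BY σ →
    ∃[ τ ] ∃[ t ] (c ⊢ σ ⇓ τ [ t ]) × t ≤ K * (n * n) × Output G ⁅ x ⁆ BY τ)

{-# OPTIONS --safe #-}

-- B is generating iff some independent subset of M₂(B) dominates M₁(B).  In a chordal graph two
-- non-adjacent vertices cannot be joined by paths with non-empty interiors in two disjoint sets
-- without edges between them (separation).  Since M₂(B) is at distance at least 2 from B, applying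
-- this to M₂(B) and B shows that the neighbours in M₁(B) of a component C of G[M₂(B)] form a clique.
-- A further application shows that, if w ∈ C misses such a neighbour v, the first vertex z adjacent
-- to v on a path in C leaving w satisfies f(w) ⊊ f(z).  So a vertex of C maximising |f| sees
-- everything in M₁(B) that C sees, and the chosen vertices dominate whatever M₂(B) dominates.
--
-- The algorithm makes boundedly many passes over the adjacency matrix.  Components are found by
-- merging, for each vertex of M₂(B) in turn, the label classes met by its neighbourhood, and S
-- consists of the vertices of M₂(B) that no vertex of their component beats, ties in |f| being
-- broken by the index.
module Submission where

open import Defs
open import Data.Bool using (Bool; true; false; T; not; if_then_else_; _∧_; _∨_)
open import Data.Bool.Properties using (T?; T-≡)
open import Data.Empty using (⊥; ⊥-elim)
open import Data.Fin as Fin using (Fin; toℕ; fromℕ<)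
open import Data.Fin.Properties using (any?; toℕ<n; toℕ-injective; toℕ-fromℕ<; fromℕ<-toℕ; nonZeroIndex)
open import Data.Fin.Subset using (Subset; _∈_; _∉_; _⊆_; _∪_; ⁅_⁆; ∣_∣)
open import Data.Fin.Subset.Properties
open import Data.List using (List; []; _∷_)
open import Data.Nat using (ℕ; zero; suc; _+_; _*_; _∸_; _≤_; _<_; z≤n; s≤s; _≡ᵇ_; _<ᵇ_; NonZero; >-nonZero⁻¹)
open import Data.Nat.Properties
open import Data.Nat.Tactic.RingSolver using (solve-∀)
open import Data.Product using (∃-syntax; _×_; _,_; proj₁; proj₂)
open import Data.Sum using (_⊎_; inj₁; inj₂; [_,_]′; swap)
open import Data.Unit using (⊤; tt)
open import Data.Vec using (lookup; tabulate; []; _∷_)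
open import Data.Vec.Properties using (lookup∘tabulate; []=⇒lookup; lookup⇒[]=)
open import Function using (_⇔_; _∘_; mk⇔; Equivalence; case_of_)
open import Level using (0ℓ)
open import Relation.Binary.Construct.Closure.ReflexiveTransitive using (Star; ε; _◅_; _◅◅_; reverse)
open import Relation.Binary.Definitions using (tri<; tri≈; tri>)
open import Relation.Binary.PropositionalEquality
open import Relation.Nullary using (¬_; Dec; yes; no; does; _×-dec_; _⊎-dec_; ¬?; contradiction; Reflects; ofʸ; ofⁿ)
open import Relation.Nullary.Decidable using (dec-true; dec-false)
open import Relation.Nullary.Reflects using (det; ¬-reflects; _×-reflects_; _⊎-reflects_; fromEquivalence; T-reflects)
open import Relation.Unary using (Pred; Decidable)

-- Neighbourhoods and induced paths

-- The equivalence closes in three moves. A witness for generation only shows that M₂(B) as a whole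
-- dominates M₁(B): a vertex of M₁(B) touches one side of `B`, so it is barred from the witness, and
-- maximality on the other side supplies a neighbour, which lies in M₂(B). The maximal choices pass
-- this on to `S`. Conversely `S` is extended greedily among the vertices outside the closed
-- neighbourhood of `B`; a vertex touching exactly one side lies in M₁(B) and is seen by `S`, and a
-- vertex touching neither side is handled by the greedy extension. Chordality is used once before
-- the cliques: in a general graph a vertex of M₂(B_Y) may be adjacent to B_X, and excluding this
-- leaves no edges between M₂(B) and `B`. On the machine the obstacle is the missing multiplication.
-- The matrix offset is therefore counted upwards across a whole double loop and never computed from
-- `u` and `v`.

∈-toSubset⁺ : ∀ {n ℓ} {P : Pred (Fin n) ℓ} (P? : Decidable P) {v} → P v → v ∈ toSubset P?
∈-toSubset⁺ P? {v} p =
  lookup⇒[]= v _ (trans (lookup∘tabulate (does ∘ P?) v) (dec-true (P? v) p))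

∈-toSubset⁻ : ∀ {n ℓ} {P : Pred (Fin n) ℓ} (P? : Decidable P) {v} → v ∈ toSubset P? → P v
∈-toSubset⁻ P? {v} v∈ with P? v | trans (sym (lookup∘tabulate (does ∘ P?) v)) ([]=⇒lookup v∈)
... | yes p | _ = p

module _ {n : ℕ} (G : Graph n) where
  open Graph G

  symmetric : ∀ {u v} → Adj u v → Adj v u
  symmetric {u} {v} = subst T (adj-sym u v)

  irreflexive : ∀ {v} → ¬ Adj v v
  irreflexive {v} = subst T (no-loop v)

  adjacent⇒≢ : ∀ {u v} → Adj u v → u ≢ v
  adjacent⇒≢ a refl = irreflexive a

  Touches : Subset n → Fin n → Set
  Touches S v = ∃[ s ] s ∈ S × Adj v s

  touches? : ∀ S v → Dec (Touches S v)
  touches? S v = any? λ s → (s ∈? S) ×-dec T? (adj v s)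

  setDistance-0 : ∀ {S v} → SetDistance G v S 0 → v ∈ S
  setDistance-0 ((s , s∈S , refl , _) , _) = s∈S

  ∈N₁⁺ : ∀ {S v} → v ∉ S → Touches S v → v ∈ N G 1 S
  ∈N₁⁺ {S} {v} v∉S (s , s∈S , a) = ∈-toSubset⁺ (λ v → setDistance? G v S 1)
    ( (s , s∈S , (s , a , refl) , λ { {zero} _ refl → v∉S s∈S ; {suc _} (s≤s ()) })
    , λ { _ s′∈S {zero} _ (refl , _) → v∉S s′∈S ; _ _ {suc _} (s≤s ()) })

  ∈N₁⁻ : ∀ {S v} → v ∈ N G 1 S → v ∉ S × Touches S v
  ∈N₁⁻ {S} v∈ with ∈-toSubset⁻ (λ v → setDistance? G v S 1) v∈
  ... | (s , s∈S , (_ , a , refl) , _) , far =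
    (λ v∈S → far _ v∈S (s≤s z≤n) (refl , λ ())) , s , s∈S , a

  ∈N₂⁺ : ∀ {S u v} → v ∉ S → ¬ Touches S v → Adj v u → Touches S u → v ∈ N G 2 S
  ∈N₂⁺ {S} {u} {v} v∉S ¬t a (s , s∈S , b) = ∈-toSubset⁺ (λ v → setDistance? G v S 2)
    ((s , s∈S , (u , a , s , b , refl) , noWalk s∈S) , λ { s s∈S j<2 (w , _) → noWalk s∈S j<2 w })
    where
    noWalk : ∀ {s j} → s ∈ S → j < 2 → ¬ Walk G j v s
    noWalk {j = zero}        s∈S _ refl           = v∉S s∈S
    noWalk {j = suc zero}    s∈S _ (_ , a , refl) = ¬t (_ , s∈S , a)
    noWalk {j = suc (suc _)} _ (s≤s (s≤s ()))

  ∈N₂⁻ : ∀ {S v} → v ∈ N G 2 S → v ∉ S × ¬ Touches S v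
  ∈N₂⁻ {S} {v} v∈ with ∈-toSubset⁻ (λ v → setDistance? G v S 2) v∈
  ... | _ , far = v∉S , λ (s , s∈S , a) →
      far s s∈S (s≤s (s≤s z≤n))
        ((s , a , refl) , λ { {zero} _ refl → v∉S s∈S ; {suc _} (s≤s ()) })
    where
    v∉S : v ∉ S
    v∉S v∈S = far v v∈S (s≤s z≤n) (refl , λ ())

  ∈N≤1⁺ : ∀ {S v} → v ∈ S ⊎ Touches S v → v ∈ N≤ G 1 S
  ∈N≤1⁺ {S} {v} near with v ∈? S
  ... | yes v∈S = ∈-toSubset⁺ (λ v → anyUpTo? (setDistance? G v S) 2)
                    (0 , s≤s z≤n , (v , v∈S , refl , λ ()) , λ _ _ ())
  ... | no v∉S  = ∈-toSubset⁺ (λ v → anyUpTo? (setDistance? G v S) 2)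
                    (1 , s≤s (s≤s z≤n) , ∈-toSubset⁻ (λ v → setDistance? G v S 1)
                      (∈N₁⁺ v∉S ([ (λ v∈S → contradiction v∈S v∉S) , (λ t → t) ]′ near)))

  ∈N≤1⁻ : ∀ {S v} → v ∈ N≤ G 1 S → v ∈ S ⊎ Touches S v
  ∈N≤1⁻ {S} v∈ with ∈-toSubset⁻ (λ v → anyUpTo? (setDistance? G v S) 2) v∈
  ... | 0 , _ , d = inj₁ (setDistance-0 d)
  ... | 1 , _ , d = inj₂ (proj₂ (∈N₁⁻ (∈-toSubset⁺ (λ v → setDistance? G v S 1) d)))
  ... | suc (suc _) , s≤s (s≤s ()) , _

  -- `P` is asked of the source of each step, hence not of the final vertex. A path from `u` to `v`
  -- with interior in `A` is thus a `Trail (λ z → z ≡ u ⊎ A z) u v`.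
  Trail : Pred (Fin n) 0ℓ → Fin n → Fin n → Set
  Trail P = Star (λ a b → P a × Adj a b)

  -- Positions range over all of `ℕ` and only those up to `k` carry meaning, so dropping the first
  -- vertex is a shift of `at` without casts. Consecutive vertices differ because there are no
  -- loops, so `chordless` speaks of the other pairs only.
  record InducedPath (P : Pred (Fin n) 0ℓ) (u v : Fin n) (k : ℕ) : Set where
    field
      at        : ℕ → Fin n
      start     : at 0 ≡ u
      end       : at k ≡ v
      inside    : ∀ {i} → i < k → P (at i)
      edge      : ∀ {i} → i < k → Adj (at i) (at (suc i))
      chordless : ∀ {i j} → suc i < j → j ≤ k → at i ≢ at j × ¬ Adj (at i) (at j)

  module _ {P : Pred (Fin n) 0ℓ} where
    open InducedPath

    tail : ∀ {u v k} (p : InducedPath P u v (suc k)) → InducedPath P (at p 1) v k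
    tail p = record
      { at        = λ i → at p (suc i)
      ; start     = refl
      ; end       = end p
      ; inside    = λ i<k → inside p (s≤s i<k)
      ; edge      = λ i<k → edge p (s≤s i<k)
      ; chordless = λ i<j j≤k → chordless p (s≤s i<j) (s≤s j≤k)
      }

    cons : ∀ {u a v k} (p : InducedPath P a v k) → P u → Adj u a →
           (∀ {j} → j < k → u ≢ at p (suc j) × ¬ Adj u (at p (suc j))) →
           InducedPath P u v (suc k)
    cons {u} p pu a far = record
      { at        = λ { zero → u ; (suc i) → at p i }
      ; start     = refl
      ; end       = end p
      ; inside    = λ { {zero} _ → pu ; {suc _} (s≤s i<k) → inside p i<k }
      ; edge      = λ { {zero} _ → subst (Adj u) (sym (start p)) a
                      ; {suc _} (s≤s i<k) → edge p i<k }
      ; chordless = λ { {zero} {suc (suc j)} _ (s≤s j<k) → far j<k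
                      ; {zero} {suc zero} (s≤s ()) _
                      ; {suc _} {suc _} (s≤s i<j) (s≤s j≤k) → chordless p i<j j≤k }
      }

    -- Shortcut at the last vertex of the path that equals u or is adjacent to u.
    prepend : ∀ {u a v} k (p : InducedPath P a v k) → P u → u ≡ a ⊎ Adj u a →
              ∃[ l ] InducedPath P u v l
    prepend-near : ∀ {u a v} k (p : InducedPath P a v k) → P u →
                   ∀ {j} → j ≤ k → u ≡ at p j ⊎ Adj u (at p j) → ∃[ l ] InducedPath P u v l
    prepend {u} k p pu near
      -- The search returns some hit, not the last one. `prepend-near` moves there and the search
      -- restarts on the strictly shorter remainder.
      with anyUpTo? (λ j → (u Fin.≟ at p (suc j)) ⊎-dec T? (adj u (at p (suc j)))) k
    prepend (suc k) p pu near | yes (j , s≤s j≤k , near′) = prepend-near k (tail p) pu j≤k near′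
    prepend k p pu (inj₁ refl) | no _ = k , p
    prepend k p pu (inj₂ a)    | no none =
      suc k , cons p pu a (λ j<k → (λ e → none (_ , j<k , inj₁ e)) , λ b → none (_ , j<k , inj₂ b))
    prepend-near k p pu {zero} _ near =
      prepend k p pu (subst (λ z → _ ≡ z ⊎ Adj _ z) (start p) near)
    prepend-near (suc k) p pu {suc j} (s≤s j≤k) near = prepend-near k (tail p) pu j≤k near

    induce : ∀ {u v} → Trail P u v → ∃[ k ] InducedPath P u v k
    induce {u} ε = 0 , record
      { at = λ _ → u ; start = refl ; end = refl ; inside = λ () ; edge = λ ()
      ; chordless = λ { {j = zero} () ; {j = suc _} _ () } }
    induce ((pu , a) ◅ t) with induce t
    ... | k , p = prepend k p pu (inj₂ a)

    interior : ∀ {u v k} (p : InducedPath P u v k) → ∀ {i} → i < k → 0 < i → at p i ≢ u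
    interior p {suc zero}    i<k _ e =
      irreflexive (subst (λ z → Adj z (at p 1)) (trans (start p) (sym e)) (edge p (<-trans (s≤s z≤n) i<k)))
    interior p {suc (suc i)} i<k _ e =
      proj₁ (chordless p (s≤s (s≤s z≤n)) (<⇒≤ i<k)) (trans (start p) (sym e))

    long : ∀ {u v k} → u ≢ v → ¬ Adj u v → InducedPath P u v k → 2 ≤ k
    long {k = zero}        u≢v _ p = contradiction (trans (sym (start p)) (end p)) u≢v
    long {k = suc zero}    _ ¬a  p = contradiction (subst₂ Adj (start p) (end p) (edge p (s≤s z≤n))) ¬a
    long {k = suc (suc _)} _ _   _ = s≤s (s≤s z≤n)

    apart : ∀ {u v k} (p : InducedPath P u v k) → ∀ {i j} → i < j → j ≤ k →
            at p i ≢ at p j × (Adj (at p i) (at p j) → j ≡ suc i)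
    apart p {i} {j} i<j j≤k with m≤n⇒m<n∨m≡n i<j
    ... | inj₁ 1+i<j = proj₁ (chordless p 1+i<j j≤k) , λ a → contradiction a (proj₂ (chordless p 1+i<j j≤k))
    ... | inj₂ refl  = adjacent⇒≢ (edge p j≤k) , λ _ → refl

  -- Gluing two induced paths into an induced cycle

  module Glue {A B : Pred (Fin n) 0ℓ} {u v k l}
    (p : InducedPath (λ z → z ≡ u ⊎ A z) u v k) (q : InducedPath (λ z → z ≡ v ⊎ B z) v u l)
    (2≤k : 2 ≤ k) (2≤l : 2 ≤ l) (anticomplete : ∀ {a b} → A a → B b → a ≢ b × ¬ Adj a b) where
    open InducedPath

    -- Position `k + i` is vertex `i` of `q`; the paths agree at position `k`, where both are at
    -- `v`. Position `k + l` would be `u` again, so the cycle consists of the positions below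
    -- `k + l`.
    around : ℕ → Fin n
    around i with i ≤? k
    ... | yes _ = at p i
    ... | no  _ = at q (i ∸ k)

    around-left : ∀ {i} → i ≤ k → around i ≡ at p i
    around-left {i} i≤k with i ≤? k
    ... | yes _  = refl
    ... | no i≰k = contradiction i≤k i≰k

    around-right : ∀ i → around (k + i) ≡ at q i
    around-right i with k + i ≤? k
    ... | no _ = cong (at q) (m+n∸m≡n k i)
    around-right zero | yes _ = trans (cong (at p) (+-identityʳ k)) (trans (end p) (sym (start q)))
    around-right (suc i) | yes le = contradiction le (<⇒≱ (m<m+n k (s≤s z≤n)))

    locate : ∀ i → i ≤ k ⊎ ∃[ j ] 0 < j × k + j ≡ i
    locate i with i ≤? k
    ... | yes i≤k = inj₁ i≤k
    ... | no i≰k with m≤n⇒∃[o]m+o≡n (≰⇒> i≰k)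
    ...   | j , e = inj₂ (suc j , s≤s z≤n , trans (+-suc k j) e)

    interior-A : ∀ {i} → 0 < i → i < k → A (at p i)
    interior-A 0<i i<k = [ (λ e → contradiction e (interior p i<k 0<i)) , (λ a → a) ]′ (inside p i<k)

    interior-B : ∀ {i} → 0 < i → i < l → B (at q i)
    interior-B 0<i i<l = [ (λ e → contradiction e (interior q i<l 0<i)) , (λ b → b) ]′ (inside q i<l)

    -- Meant for `i < j`: the only adjacent pairs are the successive ones and the closing pair of
    -- the first and the last position. Symmetry later covers `j < i`.
    Spaced : ℕ → ℕ → Set
    Spaced i j = around i ≢ around j ×
      (Adj (around i) (around j) → j ≡ suc i ⊎ (i ≡ 0 × suc j ≡ k + l))

    spaced-right : ∀ {i j} → i < j → j ≤ l → Spaced (k + i) (k + j)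
    spaced-right {i} {j} i<j j≤l
      rewrite around-right i | around-right j =
        proj₁ (apart q i<j j≤l) ,
        λ a → inj₁ (trans (cong (k +_) (proj₂ (apart q i<j j≤l) a)) (+-suc k i))

    -- Both ends of `p` also lie on `q`: position `k` is the start of `q` and position 0 is its end.
    -- These two cases are therefore settled inside `q`, and `anticomplete` is left with interior
    -- against interior.
    spaced-beyond : ∀ i {j} → i ≤ k → 0 < j → j < l → Spaced i (k + j)
    spaced-beyond i {j} i≤k 0<j j<l with m≤n⇒m<n∨m≡n i≤k
    ... | inj₂ refl = subst (λ m → Spaced m (k + j)) (+-identityʳ k) (spaced-right 0<j (<⇒≤ j<l))
    spaced-beyond zero {j} _ 0<j j<l | inj₁ _
      rewrite around-right j | around-left {0} z≤n | trans (start p) (sym (end q)) =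
        ≢-sym (proj₁ (apart q j<l ≤-refl)) ,
        λ a → inj₂ (refl , trans (sym (+-suc k j)) (cong (k +_) (sym (proj₂ (apart q j<l ≤-refl) (symmetric a)))))
    spaced-beyond (suc i) {j} _ 0<j j<l | inj₁ i<k
      rewrite around-right j | around-left (<⇒≤ i<k) =
        let (a≢b , ¬a) = anticomplete (interior-A (s≤s z≤n) i<k) (interior-B 0<j j<l)
        in a≢b , λ a → contradiction a ¬a

    spaced : ∀ {i j} → i < j → j < k + l → Spaced i j
    spaced {i} {j} i<j j<m with locate j | locate i
    ... | inj₁ j≤k | _ rewrite around-left j≤k | around-left (≤-trans (<⇒≤ i<j) j≤k) =
      proj₁ (apart p i<j j≤k) , λ a → inj₁ (proj₂ (apart p i<j j≤k) a)
    ... | inj₂ (j′ , 0<j′ , refl) | inj₁ i≤k = spaced-beyond i i≤k 0<j′ (+-cancelˡ-< k j′ l j<m)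
    ... | inj₂ (j′ , _ , refl) | inj₂ (i′ , _ , refl) =
      spaced-right (+-cancelˡ-< k i′ j′ i<j) (+-cancelˡ-≤ k j′ l (<⇒≤ j<m))

    edge-right : ∀ i → i < l → Adj (around (k + i)) (around (suc (k + i)))
    edge-right i i<l = subst₂ Adj (sym (around-right i))
      (sym (trans (cong around (sym (+-suc k i))) (around-right (suc i)))) (edge q i<l)

    next : ∀ {i} → suc i < k + l → Adj (around i) (around (suc i))
    next {i} 1+i<m with locate i
    ... | inj₂ (i′ , _ , refl) =
      edge-right i′ (<-trans (n<1+n i′) (+-cancelˡ-< k (suc i′) l (subst (_< k + l) (sym (+-suc k i′)) 1+i<m)))
    ... | inj₁ i≤k with m≤n⇒m<n∨m≡n i≤k
    ...   | inj₁ i<k = subst₂ Adj (sym (around-left (<⇒≤ i<k))) (sym (around-left i<k)) (edge p i<k)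
    ...   | inj₂ refl = subst (λ i → Adj (around i) (around (suc i))) (+-identityʳ k)
                          (edge-right 0 (≤-trans (s≤s z≤n) 2≤l))

    close : ∀ {i} → suc i ≡ k + l → Adj (around i) (around 0)
    close {i} e with m≤n⇒∃[o]m+o≡n {k} {i}
                       (≤-pred (subst (suc k ≤_) (sym e) (m<m+n k (≤-trans (s≤s z≤n) 2≤l))))
    ... | i′ , refl rewrite around-right i′ | around-left {0} z≤n | trans (start p) (sym (end q))
          | sym (+-cancelˡ-≡ k (suc i′) l (trans (+-suc k i′) e)) = edge q ≤-refl

    cycle : InducedCycle G (k + l)
    cycle = record
      { 3≤m       = ≤-trans (n≤1+n 3) (+-mono-≤ 2≤k 2≤l)
      ; vertex    = λ i → around (toℕ i)
      ; injective = λ {i} {j} e → inj e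
      ; induced   = λ i j → mk⇔ (to i j) (from i j)
      }
      where
      inj : ∀ {i j : Fin (k + l)} → around (toℕ i) ≡ around (toℕ j) → i ≡ j
      inj {i} {j} e with <-cmp (toℕ i) (toℕ j)
      ... | tri< i<j _ _ = contradiction e (proj₁ (spaced i<j (toℕ<n j)))
      ... | tri≈ _ i≡j _ = toℕ-injective i≡j
      ... | tri> _ _ j<i = contradiction (sym e) (proj₁ (spaced j<i (toℕ<n i)))

      ordered : ∀ {i j : Fin (k + l)} → toℕ i < toℕ j → Adj (around (toℕ i)) (around (toℕ j)) → CyclicNeighbours i j
      ordered {i} {j} i<j a with proj₂ (spaced i<j (toℕ<n j)) a
      ... | inj₁ j≡1+i      = inj₁ (inj₁ j≡1+i)
      ... | inj₂ (i≡0 , e) = inj₂ (inj₂ (i≡0 , e))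

      to : ∀ (i j : Fin (k + l)) → Adj (around (toℕ i)) (around (toℕ j)) → CyclicNeighbours i j
      to i j a with <-cmp (toℕ i) (toℕ j)
      ... | tri< i<j _ _ = ordered i<j a
      ... | tri≈ _ i≡j _ = contradiction (cong around i≡j) (adjacent⇒≢ a)
      ... | tri> _ _ j<i = swap (ordered {j} {i} j<i (symmetric a))

      successor : ∀ (i j : Fin (k + l)) → toℕ j ≡ suc (toℕ i) ⊎ (toℕ j ≡ 0 × suc (toℕ i) ≡ k + l) →
                  Adj (around (toℕ i)) (around (toℕ j))
      successor i j (inj₁ e)         rewrite e = next (subst (_< k + l) e (toℕ<n j))
      successor i j (inj₂ (j≡0 , e)) rewrite j≡0 = close e

      from : ∀ (i j : Fin (k + l)) → CyclicNeighbours i j → Adj (around (toℕ i)) (around (toℕ j))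
      from i j (inj₁ nx) = successor i j nx
      from i j (inj₂ nx) = symmetric (successor j i nx)

  -- Induced paths through A and through B together form an induced cycle with at least 4 vertices.
  separation : Chordal G → ∀ {A B : Pred (Fin n) 0ℓ} {u v} → u ≢ v → ¬ Adj u v →
    (∀ {a b} → A a → B b → a ≢ b × ¬ Adj a b) →
    Trail (λ z → z ≡ u ⊎ A z) u v → Trail (λ z → z ≡ v ⊎ B z) v u → ⊥
  separation chordal u≢v ¬a anticomplete s t with induce s | induce t
  ... | k , p | l , q = <⇒≢ (+-mono-≤ 2≤k 2≤l) (sym (chordal (k + l) (Glue.cycle p q 2≤k 2≤l anticomplete)))
    where
    2≤k : 2 ≤ k
    2≤k = long u≢v ¬a p
    2≤l : 2 ≤ l
    2≤l = long (≢-sym u≢v) (λ a → ¬a (symmetric a)) q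

-- Components by label merging

-- Repeatedly merging the label classes met by a neighbourhood leaves the components of G[U].
module Labelling {n : ℕ} (G : Graph n) (U : Subset n) where
  open Graph G

  -- The class of `v` contains a neighbour of `u` inside `U`. Membership of `u` in `U` is part of
  -- the condition, so processing a vertex outside `U` changes nothing.
  Merged : Fin n → (Fin n → ℕ) → Fin n → Set
  Merged u l v = ∃[ b ] (u ∈ U × b ∈ U × Adj u b) × l b ≡ l v

  merged? : ∀ u l v → Dec (Merged u l v)
  merged? u l v = any? λ b → ((u ∈? U) ×-dec (b ∈? U) ×-dec T? (adj u b)) ×-dec (l b ≟ l v)

  relabel : Fin n → (Fin n → ℕ) → Fin n → ℕ
  relabel u l v = if does (merged? u l v) then l u else l v

  relabel-yes : ∀ u l {v} → Merged u l v → relabel u l v ≡ l u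
  relabel-yes u l {v} m rewrite dec-true (merged? u l v) m = refl

  relabel-no : ∀ u l {v} → ¬ Merged u l v → relabel u l v ≡ l v
  relabel-no u l {v} ¬m rewrite dec-false (merged? u l v) ¬m = refl

  -- Indexed by the number of processed vertices, so that it can serve as the invariant of a machine
  -- loop.
  labels : ℕ → Fin n → ℕ
  labels zero    = toℕ
  labels (suc i) with i <? n
  ... | yes i<n = relabel (fromℕ< i<n) (labels i)
  ... | no _    = labels i

  labels-suc : ∀ u → labels (suc (toℕ u)) ≡ relabel u (labels (toℕ u))
  labels-suc u with toℕ u <? n
  ... | yes u<n = cong (λ v → relabel v (labels (toℕ u))) (fromℕ<-toℕ u u<n)
  ... | no u≮n  = contradiction (toℕ<n u) u≮n

  reach-sym : ∀ {u v} → Reachable G U u v → Reachable G U v u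
  reach-sym = reverse λ (u∈ , v∈ , a) → v∈ , u∈ , symmetric G a

  Sound : (Fin n → ℕ) → Set
  Sound l = ∀ {u v} → u ∈ U → v ∈ U → l u ≡ l v → Reachable G U u v

  -- Only edges with a processed endpoint count; at `i = n` these are all edges of G[U].
  Complete : ℕ → (Fin n → ℕ) → Set
  Complete i l = ∀ {u v} → toℕ u < i → u ∈ U → v ∈ U → Adj u v → l u ≡ l v

  -- A vertex whose class is merged reaches `z`: by the old soundness it reaches the neighbour of
  -- `z` in its class. The cases record which of the two vertices obtained its label by merging.
  relabel-sound : ∀ z {l} → Sound l → Sound (relabel z l)
  relabel-sound z {l} sound {u} {v} u∈ v∈ = helper (merged? z l u) (merged? z l v)
    where
    toCentre : ∀ {v} → v ∈ U → Merged z l v → Reachable G U z v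
    toCentre v∈ (b , (z∈ , b∈ , a) , e) = (z∈ , b∈ , a) ◅ sound b∈ v∈ e
    helper : Dec (Merged z l u) → Dec (Merged z l v) → relabel z l u ≡ relabel z l v → Reachable G U u v
    helper (yes m) (yes m′) e = reach-sym (toCentre u∈ m) ◅◅ toCentre v∈ m′
    helper (yes m@(_ , (z∈ , _) , _)) (no ¬m′) e =
      reach-sym (toCentre u∈ m) ◅◅ sound z∈ v∈ (trans (sym (relabel-yes z l m)) (trans e (relabel-no z l ¬m′)))
    helper (no ¬m) (yes m′@(_ , (z∈ , _) , _)) e =
      sound u∈ z∈ (trans (sym (relabel-no z l ¬m)) (trans e (relabel-yes z l m′))) ◅◅ toCentre v∈ m′
    helper (no ¬m) (no ¬m′) e =
      sound u∈ v∈ (trans (sym (relabel-no z l ¬m)) (trans e (relabel-no z l ¬m′)))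

  -- `Merged` sees `v` only through its label, so whole classes move together and no earlier merge
  -- is undone.
  relabel-cong : ∀ z l {u v} → l u ≡ l v → relabel z l u ≡ relabel z l v
  relabel-cong z l {u} {v} e = case merged? z l u of λ where
    (yes m@(b , h , e′)) → trans (relabel-yes z l m) (sym (relabel-yes z l (b , h , trans e′ e)))
    (no ¬m) → trans (relabel-no z l ¬m)
                (trans e (sym (relabel-no z l λ (b , h , e′) → ¬m (b , h , trans e′ (sym e)))))

  -- Merged classes receive the label of `z` itself, so `z` keeps its label whether or not its own
  -- class is among them.
  relabel-centre : ∀ z l → relabel z l z ≡ l z
  relabel-centre z l = case merged? z l z of λ where
    (yes m) → relabel-yes z l m
    (no ¬m) → relabel-no z l ¬m

  relabel-complete : ∀ z {l} → Complete (toℕ z) l → Complete (suc (toℕ z)) (relabel z l)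
  relabel-complete z {l} complete {u} {v} u<1+z u∈ v∈ a with m≤n⇒m<n∨m≡n (≤-pred u<1+z)
  ... | inj₁ u<z = relabel-cong z l (complete u<z u∈ v∈ a)
  ... | inj₂ u≡z rewrite toℕ-injective u≡z =
    trans (relabel-centre z l) (sym (relabel-yes z l (v , (u∈ , v∈ , a) , refl)))

  labels-sound : ∀ i → Sound (labels i)
  labels-sound zero _ _ e rewrite toℕ-injective e = ε
  labels-sound (suc i) with i <? n
  ... | yes i<n = relabel-sound (fromℕ< i<n) (labels-sound i)
  ... | no _    = labels-sound i

  labels-complete : ∀ i → Complete i (labels i)
  labels-complete zero ()
  labels-complete (suc i) {u} {v} u<1+i with i <? n
  ... | yes i<n = subst (λ j → Complete j (labels j) → Complete (suc j) (relabel (fromℕ< i<n) (labels j)))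
                    (toℕ-fromℕ< i<n) (relabel-complete (fromℕ< i<n)) (labels-complete i) u<1+i
  ... | no i≮n  = labels-complete i (<-≤-trans (toℕ<n u) (≮⇒≥ i≮n))

  label : Fin n → ℕ
  label = labels n

  label-reachable : ∀ {u v} → Reachable G U u v → label u ≡ label v
  label-reachable ε                          = refl
  label-reachable (_◅_ {i = u} (u∈ , w∈ , a) r) =
    trans (labels-complete n (toℕ<n u) u∈ w∈ a) (label-reachable r)

  inComponent? : ∀ u v → Dec (v ∈ U × label u ≡ label v)
  inComponent? u v = (v ∈? U) ×-dec (label u ≟ label v)

  component : Fin n → Subset n
  component u = toSubset (inComponent? u)

  reach-closed : ∀ {u v} → u ∈ U → Reachable G U u v → v ∈ U
  reach-closed u∈ ε                = u∈
  reach-closed _ ((_ , v∈ , _) ◅ r) = reach-closed v∈ r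

  component-is : ∀ {u} → u ∈ U → IsComponent G U (component u)
  component-is {u} u∈ = record
    { nonempty  = u , ∈-toSubset⁺ (inComponent? u) (u∈ , refl)
    ; contained = λ v∈ → proj₁ (∈-toSubset⁻ (inComponent? u) v∈)
    ; connected = λ v∈ w∈ →
        let (v∈U , e) = ∈-toSubset⁻ (inComponent? u) v∈
            (w∈U , e′) = ∈-toSubset⁻ (inComponent? u) w∈
        in labels-sound n v∈U w∈U (trans (sym e) e′)
    ; closed    = λ v∈ r →
        let (v∈U , e) = ∈-toSubset⁻ (inComponent? u) v∈
        in ∈-toSubset⁺ (inComponent? u) (reach-closed v∈U r , trans e (label-reachable r))
    }

  ∈-component : ∀ {u v} → v ∈ U → label u ≡ label v → v ∈ component u
  ∈-component {u} v∈ e = ∈-toSubset⁺ (inComponent? u) (v∈ , e)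

  component-unique : ∀ {C D} → IsComponent G U C → IsComponent G U D → ∀ {v} → v ∈ C → v ∈ D → C ≡ D
  component-unique isC isD v∈C v∈D = ⊆-antisym
    (λ u∈C → IsComponent.closed isD v∈D (IsComponent.connected isC v∈C u∈C))
    (λ u∈D → IsComponent.closed isC v∈C (IsComponent.connected isD v∈D u∈D))

swapSides : ∀ {n} {G : Graph n} {BX BY} → InducedCompleteBipartite G BX BY → InducedCompleteBipartite G BY BX
swapSides {G = G} B = record
  { nonemptyX = nonemptyY ; nonemptyY = nonemptyX
  ; independentX = independentY ; independentY = independentX
  ; complete = λ y∈ x∈ → symmetric G (complete x∈ y∈) }
  where open InducedCompleteBipartite B

-- Generating subgraphs of chordal graphs

independent-∪⁅⁆ : ∀ {n} (G : Graph n) {S v} → Independent G S → ¬ Touches G S v → Independent G (S ∪ ⁅ v ⁆)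
independent-∪⁅⁆ G {S} {v} ind ¬t {a} {b} a∈ b∈ a~b with x∈p∪q⁻ S ⁅ v ⁆ a∈ | x∈p∪q⁻ S ⁅ v ⁆ b∈
... | inj₁ a∈S | inj₁ b∈S = ind a∈S b∈S a~b
... | inj₁ a∈S | inj₂ b∈v rewrite x∈⁅y⁆⇒x≡y v b∈v = ¬t (a , a∈S , symmetric G a~b)
... | inj₂ a∈v | inj₁ b∈S rewrite x∈⁅y⁆⇒x≡y v a∈v = ¬t (b , b∈S , a~b)
... | inj₂ a∈v | inj₂ b∈v rewrite x∈⁅y⁆⇒x≡y v a∈v | x∈⁅y⁆⇒x≡y v b∈v = irreflexive G a~b

maximal-touches : ∀ {n} (G : Graph n) {S v} → MaximalIndependent G S → v ∉ S → Touches G S v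
maximal-touches G {S} {v} (ind , max) v∉S with touches? G S v
... | yes t = t
... | no ¬t = contradiction (max (S ∪ ⁅ v ⁆) (independent-∪⁅⁆ G {S} ind ¬t) (p⊆p∪q ⁅ v ⁆) (q⊆p∪q S ⁅ v ⁆ (x∈⁅x⁆ v))) v∉S

-- Vertices are scanned by index, and one satisfying `P` is added unless the set built so far
-- touches it. Later additions cannot spoil domination.
greedy : ∀ {n} (G : Graph n) {P : Fin n → Set} → (∀ v → Dec (P v)) →
  ∀ {S} → Independent G S → (∀ {v} → v ∈ S → P v) →
  ∃[ S′ ] S ⊆ S′ × Independent G S′ × (∀ {v} → v ∈ S′ → P v) ×
    (∀ v → P v → v ∈ S′ ⊎ Touches G S′ v)
greedy {n} G {P} P? {S} ind S⊆P =
  let (S′ , S⊆S′ , ind′ , S′⊆P , dom) = upTo n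
  in S′ , S⊆S′ , ind′ , S′⊆P , λ v pv → dom v (toℕ<n v) pv
  where
  upTo : ∀ i → ∃[ S′ ] S ⊆ S′ × Independent G S′ × (∀ {v} → v ∈ S′ → P v) ×
    (∀ v → toℕ v < i → P v → v ∈ S′ ⊎ Touches G S′ v)
  upTo zero = S , (λ v∈ → v∈) , ind , S⊆P , λ _ ()
  upTo (suc i) with i <? n
  ... | no i≮n = let (S′ , S⊆S′ , ind′ , S′⊆P , dom) = upTo i
                 in S′ , S⊆S′ , ind′ , S′⊆P , λ v _ → dom v (<-≤-trans (toℕ<n v) (≮⇒≥ i≮n))
  ... | yes i<n with upTo i
  ...   | S′ , S⊆S′ , ind′ , S′⊆P , dom with P? (fromℕ< i<n) | touches? G S′ (fromℕ< i<n)
  ...     | no ¬p | _ = S′ , S⊆S′ , ind′ , S′⊆P , dom′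
    where
    dom′ : ∀ v → toℕ v < suc i → P v → v ∈ S′ ⊎ Touches G S′ v
    dom′ v v≤i pv with m≤n⇒m<n∨m≡n (≤-pred v≤i)
    ... | inj₁ v<i = dom v v<i pv
    ... | inj₂ refl = contradiction (subst P (sym (fromℕ<-toℕ v i<n)) pv) ¬p
  ...     | yes _ | yes t = S′ , S⊆S′ , ind′ , S′⊆P , dom′
    where
    dom′ : ∀ v → toℕ v < suc i → P v → v ∈ S′ ⊎ Touches G S′ v
    dom′ v v≤i pv with m≤n⇒m<n∨m≡n (≤-pred v≤i)
    ... | inj₁ v<i = dom v v<i pv
    ... | inj₂ refl = inj₂ (subst (Touches G S′) (fromℕ<-toℕ v i<n) t)
  ...     | yes p | no ¬t = S′ ∪ ⁅ u ⁆ , (λ v∈ → p⊆p∪q ⁅ u ⁆ (S⊆S′ v∈)) , independent-∪⁅⁆ G {S′} ind′ ¬t , ⊆P , dom′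
    where
    u : Fin n
    u = fromℕ< i<n
    ⊆P : ∀ {v} → v ∈ S′ ∪ ⁅ u ⁆ → P v
    ⊆P v∈ with x∈p∪q⁻ S′ ⁅ u ⁆ v∈
    ... | inj₁ v∈S = S′⊆P v∈S
    ... | inj₂ v∈u rewrite x∈⁅y⁆⇒x≡y u v∈u = p
    dom′ : ∀ v → toℕ v < suc i → P v → v ∈ S′ ∪ ⁅ u ⁆ ⊎ Touches G (S′ ∪ ⁅ u ⁆) v
    dom′ v v≤i pv with m≤n⇒m<n∨m≡n (≤-pred v≤i)
    ... | inj₁ v<i = [ (λ v∈ → inj₁ (p⊆p∪q ⁅ u ⁆ v∈)) ,
                       (λ (s , s∈ , a) → inj₂ (s , p⊆p∪q ⁅ u ⁆ s∈ , a)) ]′ (dom v v<i pv)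
    ... | inj₂ refl = inj₁ (subst (_∈ S′ ∪ ⁅ u ⁆) (fromℕ<-toℕ v i<n) (q⊆p∪q S′ ⁅ u ⁆ (x∈⁅x⁆ u)))

-- Membership criteria free of distances

module Characterisation {n : ℕ} (G : Graph n) {BU BV : Subset n} (B : InducedCompleteBipartite G BU BV) where
  open Graph G
  open InducedCompleteBipartite B renaming (nonemptyX to nonemptyU; nonemptyY to nonemptyV)

  -- A neighbour in `BV` is adjacent to all of `BU` and so witnesses distance 2. A vertex of `BV`
  -- would touch `BU`, which gives `v ∉ BV`.
  ∈M₁-of⁺ : ∀ {v} → Touches G BV v × ¬ Touches G BU v × v ∉ BU → v ∈ M₁-of G BU BV
  ∈M₁-of⁺ {v} (t@(b , b∈ , a) , ¬t , v∉BU) = x∈p∩q⁺ {p = N G 1 BV} {N G 2 BU}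
    ( ∈N₁⁺ G {BV} (λ v∈BV → ¬t (proj₁ nonemptyU , proj₂ nonemptyU , symmetric G (complete (proj₂ nonemptyU) v∈BV))) t
    , ∈N₂⁺ G {BU} v∉BU ¬t a (proj₁ nonemptyU , proj₂ nonemptyU , symmetric G (complete (proj₂ nonemptyU) b∈)))

  ∈M₁-of⁻ : ∀ {v} → v ∈ M₁-of G BU BV → Touches G BV v × ¬ Touches G BU v × v ∉ BU
  ∈M₁-of⁻ v∈ with x∈p∩q⁻ (N G 1 BV) (N G 2 BU) v∈
  ... | v∈N₁ , v∈N₂ = proj₂ (∈N₁⁻ G {BV} v∈N₁) , proj₂ (∈N₂⁻ G {BU} v∈N₂) , proj₁ (∈N₂⁻ G {BU} v∈N₂)

  -- The neighbour in M₁ touches `BV`, which gives the walk of length 2; and `w` is itself outside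
  -- M₁, as every vertex of M₁ touches `BV`.
  ∈M₂-of⁺ : ∀ {w} → Touches G (M₁-of G BU BV) w × ¬ Touches G BV w × w ∉ BV → w ∈ M₂-of G BU BV BV
  ∈M₂-of⁺ (t@(v , v∈ , a) , ¬t , w∉BV) = x∈p∩q⁺ {p = N G 1 (M₁-of G BU BV)} {N G 2 BV}
    ( ∈N₁⁺ G {M₁-of G BU BV} (λ w∈M₁ → ¬t (proj₁ (∈M₁-of⁻ w∈M₁))) t
    , ∈N₂⁺ G {BV} w∉BV ¬t a (proj₁ (∈M₁-of⁻ v∈)))

  ∈M₂-of⁻ : ∀ {w} → w ∈ M₂-of G BU BV BV → Touches G (M₁-of G BU BV) w × ¬ Touches G BV w × w ∉ BV
  ∈M₂-of⁻ w∈ with x∈p∩q⁻ (N G 1 (M₁-of G BU BV)) (N G 2 BV) w∈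
  ... | w∈N₁ , w∈N₂ = proj₂ (∈N₁⁻ G {M₁-of G BU BV} w∈N₁) , proj₂ (∈N₂⁻ G {BV} w∈N₂) , proj₁ (∈N₂⁻ G {BV} w∈N₂)

  ∈M₁-of : ∀ {v} → v ∈ M₁-of G BU BV ⇔ (Touches G BV v × ¬ Touches G BU v × v ∉ BU)
  ∈M₁-of = mk⇔ ∈M₁-of⁻ ∈M₁-of⁺

  ∈M₂-of : ∀ {w} → w ∈ M₂-of G BU BV BV ⇔ (Touches G (M₁-of G BU BV) w × ¬ Touches G BV w × w ∉ BV)
  ∈M₂-of = mk⇔ ∈M₂-of⁻ ∈M₂-of⁺

-- M and W stand for M₁(BV) and M₂(BV).  Here and below such sets are parameters known only by their
-- membership criteria: the definitions of M₁ and M₂ unfold to terms too large to be compared.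
module Side {n : ℕ} (G : Graph n) {BU BV : Subset n} (B : InducedCompleteBipartite G BU BV) (M W : Subset n)
  (∈M : ∀ {v} → v ∈ M ⇔ (Touches G BV v × ¬ Touches G BU v × v ∉ BU))
  (∈W : ∀ {w} → w ∈ W ⇔ (Touches G M w × ¬ Touches G BV w × w ∉ BV)) where
  open Graph G
  open InducedCompleteBipartite B renaming (nonemptyX to nonemptyU; nonemptyY to nonemptyV)

  -- A neighbour of w in BU would close an induced 4-cycle.
  W-free : Chordal G → ∀ {w} → w ∈ W → (w ∉ BU × ¬ Touches G BU w) × (w ∉ BV × ¬ Touches G BV w)
  W-free chordal {w} w∈ with Equivalence.to ∈W w∈
  ... | (v , v∈ , w~v) , ¬t , w∉BV with Equivalence.to ∈M v∈
  ...   | (b , b∈ , v~b) , ¬t′ , v∉BU =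
    ((λ w∈BU → ¬t (b , b∈ , complete w∈BU b∈)) ,
     λ (c , c∈ , w~c) → separation G chordal {_≡ b} {_≡ w}
      (λ { refl → v∉BU c∈ }) (λ v~c → ¬t′ (c , c∈ , v~c))
      (λ { refl refl → (λ { refl → w∉BV b∈ }) , λ b~w → ¬t (b , b∈ , symmetric G b~w) })
      ((inj₁ refl , v~b) ◅ (inj₂ refl , symmetric G (complete c∈ b∈)) ◅ ε)
      ((inj₁ refl , symmetric G w~c) ◅ (inj₂ refl , w~v) ◅ ε)) ,
    w∉BV , ¬t

  -- The neighbour of `v` in `BV` keeps `v` out of `S`, so maximality of `S ∪ BU` gives `v` a
  -- neighbour there. It is not in `BU`, which `v` does not touch, and independence on both sides
  -- then places it in `W`.
  seen : ∀ {S} → Independent G (S ∪ BV) → MaximalIndependent G (S ∪ BU) →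
         ∀ {v} → v ∈ M → ∃[ t ] t ∈ W × Adj v t
  seen {S} indV maxU {v} v∈ with Equivalence.to ∈M v∈
  ... | (b , b∈ , v~b) , ¬t , v∉BU with maximal-touches G maxU (λ v∈∪ →
          [ (λ v∈S → indV (p⊆p∪q BV v∈S) (q⊆p∪q S BV b∈) v~b) , v∉BU ]′ (x∈p∪q⁻ S BU v∈∪))
  ...   | t , t∈∪ , v~t with x∈p∪q⁻ S BU t∈∪
  ...     | inj₂ t∈BU = contradiction (t , t∈BU , v~t) ¬t
  ...     | inj₁ t∈S  = t , Equivalence.from ∈W
      ( (v , v∈ , symmetric G v~t)
      , (λ (c , c∈ , t~c) → indV (p⊆p∪q BV t∈S) (q⊆p∪q S BV c∈) t~c)
      , λ t∈BV → proj₁ maxU (p⊆p∪q BU t∈S) (q⊆p∪q S BU (proj₂ nonemptyU))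
          (symmetric G (complete (proj₂ nonemptyU) t∈BV))) , v~t

  -- A further vertex of an independent superset cannot be in `BU`, as `BU` is complete to `BV`, and
  -- cannot touch `BV`; every other vertex is seen by `T`.
  completes : ∀ {T} → Independent G T → (∀ {t} → t ∈ T → t ∉ BV × ¬ Touches G BV t) →
    (∀ {v} → v ∉ BU → v ∉ BV → ¬ Touches G BV v → v ∈ T ⊎ Touches G T v) →
    MaximalIndependent G (T ∪ BV)
  completes {T} indT T-free seen = ind , max
    where
    ind : Independent G (T ∪ BV)
    ind a∈ b∈ a~b with x∈p∪q⁻ T BV a∈ | x∈p∪q⁻ T BV b∈
    ... | inj₁ a∈T | inj₁ b∈T = indT a∈T b∈T a~b
    ... | inj₁ a∈T | inj₂ b∈V = proj₂ (T-free a∈T) (_ , b∈V , a~b)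
    ... | inj₂ a∈V | inj₁ b∈T = proj₂ (T-free b∈T) (_ , a∈V , symmetric G a~b)
    ... | inj₂ a∈V | inj₂ b∈V = independentY a∈V b∈V a~b
    max : ∀ S → Independent G S → T ∪ BV ⊆ S → S ⊆ T ∪ BV
    max S indS ⊆S {v} v∈ with v ∈? BV | v ∈? BU
    ... | yes v∈V | _ = q⊆p∪q T BV v∈V
    ... | no _ | yes v∈U =
      contradiction (complete v∈U (proj₂ nonemptyV)) (indS v∈ (⊆S (q⊆p∪q T BV (proj₂ nonemptyV))))
    ... | no v∉V | no v∉U with seen v∉U v∉V (λ (b , b∈ , a) → indS v∈ (⊆S (q⊆p∪q T BV b∈)) a)
    ...   | inj₁ v∈T = p⊆p∪q BV v∈T
    ...   | inj₂ (t , t∈ , a) = contradiction a (indS v∈ (⊆S (p⊆p∪q BV t∈)))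

-- M and W stand for M₁(B) and M₂(B).
module Separated {n : ℕ} (G : Graph n) (chordal : Chordal G) {BX BY : Subset n}
  (B : InducedCompleteBipartite G BX BY) (M W : Subset n)
  (M-touches : ∀ {v} → v ∈ M → Touches G (BX ∪ BY) v)
  (W-far : ∀ {w b} → w ∈ W → b ∈ BX ∪ BY → w ≢ b × ¬ Graph.Adj G w b) where
  open Graph G
  open InducedCompleteBipartite B

  disjoint : ∀ {v} → v ∈ M → v ∉ W
  disjoint v∈M v∈W = let (b , b∈ , a) = M-touches v∈M in proj₂ (W-far v∈W b∈) a

  B-connected : ∀ {b c} → b ∈ BX ∪ BY → c ∈ BX ∪ BY → Reachable G (BX ∪ BY) b c
  B-connected {b} {c} b∈ c∈ with x∈p∪q⁻ BX BY b∈ | x∈p∪q⁻ BX BY c∈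
  ... | inj₁ b∈X | inj₂ c∈Y = (b∈ , c∈ , complete b∈X c∈Y) ◅ ε
  ... | inj₂ b∈Y | inj₁ c∈X = (b∈ , c∈ , symmetric G (complete c∈X b∈Y)) ◅ ε
  ... | inj₁ b∈X | inj₁ c∈X =
    let (y , y∈) = nonemptyY ; y∈B = q⊆p∪q BX BY y∈
    in (b∈ , y∈B , complete b∈X y∈) ◅ (y∈B , c∈ , symmetric G (complete c∈X y∈)) ◅ ε
  ... | inj₂ b∈Y | inj₂ c∈Y =
    let (x , x∈) = nonemptyX ; x∈B = p⊆p∪q BY x∈
    in (b∈ , x∈B , symmetric G (complete x∈ b∈Y)) ◅ (x∈B , c∈ , complete x∈ c∈Y) ◅ ε

  -- `P` holds on the whole trail except possibly at its end `z`. After reversal `z` is the start,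
  -- which is the form that `separation` expects.
  reverse-trail : ∀ {P w z u} → Trail G P w z → Adj w u → Trail G (λ a → a ≡ z ⊎ P a) z u
  reverse-trail ε a              = (inj₁ refl , a) ◅ ε
  reverse-trail ((pw , b) ◅ t) a = reverse-trail t (symmetric G b) ◅◅ ((inj₂ pw , a) ◅ ε)

  through : ∀ {U u b c v} → Adj u b → b ∈ U → Reachable G U b c → Adj c v →
            Trail G (λ z → z ≡ u ⊎ z ∈ U) u v
  through {U} {u} u~b b∈ r c~v = (inj₁ refl , u~b) ◅ go b∈ r
    where
    go : ∀ {b} → b ∈ U → Reachable G U b _ → Trail G (λ z → z ≡ u ⊎ z ∈ U) b _
    go b∈ ε                   = (inj₂ b∈ , c~v) ◅ ε
    go b∈ ((_ , d∈ , a) ◅ r) = (inj₂ b∈ , a) ◅ go d∈ r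

  clique : ∀ {v v′ w w′} → v ∈ M → v′ ∈ M → w ∈ W →
           Adj v w → Adj v′ w′ → Reachable G W w w′ → v ≢ v′ → Adj v v′
  clique {v} {v′} v∈ v′∈ w∈ v~w v′~w′ r v≢v′ with T? (adj v v′)
  ... | yes a = a
  ... | no ¬a =
    let (b , b∈ , v~b) = M-touches v∈ ; (c , c∈ , v′~c) = M-touches v′∈
    in ⊥-elim (separation G chordal {_∈ W} {_∈ BX ∪ BY} v≢v′ ¬a
         (λ w∈ b∈ → W-far w∈ b∈)
         (through v~w w∈ r (symmetric G v′~w′))
         (through v′~c c∈ (B-connected c∈ b∈) (symmetric G v~b)))

  -- Stopping at the first neighbour keeps `v` non-adjacent to everything before `z`. This is the
  -- anticompleteness that the closing cycle needs.
  firstNeighbour : ∀ {v w t} → w ∈ W → Adj v t → Reachable G W w t →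
    ∃[ z ] z ∈ W × Adj v z × Reachable G W w z ×
           Trail G (λ a → a ∈ W × ¬ Adj v a) w z
  firstNeighbour w∈ a ε = _ , w∈ , a , ε , ε
  firstNeighbour {v} {w} w∈ a (s@(_ , u∈ , w~u) ◅ r) with T? (adj v w)
  ... | yes v~w = w , w∈ , v~w , ε , ε
  ... | no v≁w  = let (z , z∈ , v~z , r′ , t) = firstNeighbour u∈ a r
                  in z , z∈ , v~z , s ◅ r′ , ((w∈ , v≁w) , w~u) ◅ t

  Neighbours : (Fin n → Subset n) → Set
  Neighbours F = ∀ {v w} → v ∈ F w ⇔ (v ∈ M × Adj v w)

  -- If v misses w, let z be the first neighbour of v on a path from w to t.  Every other
  -- neighbour of w in M is a neighbour of z, so |f(z)| > |f(w)|.
  maximal-sees : ∀ {F} → Neighbours F → ∀ {C w v t} → IsComponent G W C → w ∈ C →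
    (∀ u → u ∈ C → ∣ F u ∣ ≤ ∣ F w ∣) →
    v ∈ M → t ∈ C → Adj v t → Adj v w
  maximal-sees {F} ∈F {C} {w} {v} isC w∈C max v∈ t∈C v~t with T? (adj v w)
  ... | yes v~w = v~w
  ... | no v≁w with firstNeighbour (IsComponent.contained isC w∈C) v~t (IsComponent.connected isC w∈C t∈C)
  ...   | z , z∈ , v~z , r , trail =
    contradiction (max z (IsComponent.closed isC w∈C r))
      (<⇒≱ (p⊂q⇒∣p∣<∣q∣ (inclusion , v , Equivalence.from ∈F (v∈ , v~z) , λ v∈f → v≁w (proj₂ (Equivalence.to ∈F v∈f)))))
    where
    inclusion : F w ⊆ F z
    inclusion {u} u∈f with Equivalence.to ∈F u∈f
    ... | u∈ , u~w with T? (adj u z)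
    ...   | yes u~z = Equivalence.from ∈F (u∈ , u~z)
    -- The cycle runs from `u` over `v` to `z` and back along the trail through `w` to `u`. One
    -- interior is `v` alone, the other consists of vertices of `W` missing `v`; the edge from `u`
    -- to `v` comes from the clique.
    ...   | no u≁z  = ⊥-elim (separation G chordal {_≡ v} {λ a → (a ∈ W × ¬ Adj v a)}
            (λ { refl → disjoint u∈ z∈ }) u≁z
            (λ { refl (a∈ , v≁a) → (λ { refl → disjoint v∈ a∈ }) , v≁a })
            ((inj₁ refl , u~v) ◅ (inj₂ refl , v~z) ◅ ε)
            (reverse-trail trail (symmetric G u~w)))
      where
      u~v : Adj u v
      u~v = clique u∈ v∈ (IsComponent.contained isC w∈C) u~w v~z r λ { refl → v≁w u~w }

module Generation {n : ℕ} (G : Graph n) (chordal : Chordal G) {BX BY : Subset n}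
  (B : InducedCompleteBipartite G BX BY) (M₁X M₁Y M₂X M₂Y : Subset n)
  (∈M₁X : ∀ {v} → v ∈ M₁X ⇔ (Touches G BX v × ¬ Touches G BY v × v ∉ BY))
  (∈M₁Y : ∀ {v} → v ∈ M₁Y ⇔ (Touches G BY v × ¬ Touches G BX v × v ∉ BX))
  (∈M₂X : ∀ {w} → w ∈ M₂X ⇔ (Touches G M₁X w × ¬ Touches G BX w × w ∉ BX))
  (∈M₂Y : ∀ {w} → w ∈ M₂Y ⇔ (Touches G M₁Y w × ¬ Touches G BY w × w ∉ BY)) where
  open Graph G
  module X = Side G (swapSides B) M₁X M₂X ∈M₁X ∈M₂X
  module Y = Side G B M₁Y M₂Y ∈M₁Y ∈M₂Y

  M W : Subset n
  M = M₁X ∪ M₁Y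
  W = M₂X ∪ M₂Y

  open Labelling G W

  -- The complement of the closed neighbourhood of `B`: the vertices that can be joined to either
  -- side without destroying independence.
  Free : Fin n → Set
  Free v = (v ∉ BX × ¬ Touches G BX v) × (v ∉ BY × ¬ Touches G BY v)

  free? : ∀ v → Dec (Free v)
  free? v = (¬? (v ∈? BX) ×-dec ¬? (touches? G BX v)) ×-dec (¬? (v ∈? BY) ×-dec ¬? (touches? G BY v))

  M₂-free : ∀ {w} → w ∈ W → Free w
  M₂-free w∈ with x∈p∪q⁻ M₂X M₂Y w∈
  ... | inj₁ w∈X = let (fY , fX) = X.W-free chordal w∈X in fX , fY
  ... | inj₂ w∈Y = Y.W-free chordal w∈Y

  M₁-touches : ∀ {v} → v ∈ M → Touches G (BX ∪ BY) v
  M₁-touches v∈ with x∈p∪q⁻ M₁X M₁Y v∈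
  ... | inj₁ v∈X = let ((b , b∈ , a) , _) = Equivalence.to ∈M₁X v∈X in b , p⊆p∪q BY b∈ , a
  ... | inj₂ v∈Y = let ((b , b∈ , a) , _) = Equivalence.to ∈M₁Y v∈Y in b , q⊆p∪q BX BY b∈ , a

  free⇒far : ∀ {w b} → Free w → b ∈ BX ∪ BY → w ≢ b × ¬ Adj w b
  free⇒far ((w∉X , ¬x) , (w∉Y , ¬y)) b∈ with x∈p∪q⁻ BX BY b∈
  ... | inj₁ b∈X = (λ { refl → w∉X b∈X }) , λ a → ¬x (_ , b∈X , a)
  ... | inj₂ b∈Y = (λ { refl → w∉Y b∈Y }) , λ a → ¬y (_ , b∈Y , a)

  open Separated G chordal B M W M₁-touches (λ w∈ → free⇒far (M₂-free w∈)) public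

  generating⇒M₂-dominates : Generating G BX BY → ∀ {v} → v ∈ M → ∃[ t ] t ∈ W × Adj v t
  generating⇒M₂-dominates (S , _ , maxX , maxY) v∈ with x∈p∪q⁻ M₁X M₁Y v∈
  ... | inj₁ v∈X = let (t , t∈ , a) = X.seen (proj₁ maxX) maxY v∈X in t , p⊆p∪q M₂Y t∈ , a
  ... | inj₂ v∈Y = let (t , t∈ , a) = Y.seen (proj₁ maxY) maxX v∈Y in t , q⊆p∪q M₂X M₂Y t∈ , a

  module _ {F : Fin n → Subset n} (∈F : Neighbours F) {w : Subset n → Fin n} {S : Subset n}
    (chosen : ∀ C → IsComponent G W C → w C ∈ C)
    (maximal : ∀ C → IsComponent G W C → ∀ v → v ∈ C → ∣ F v ∣ ≤ ∣ F (w C) ∣)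
    (image : ∀ v → v ∈ S ⇔ (∃[ C ] IsComponent G W C × v ≡ w C)) where

    chosen-from : ∀ {v} → v ∈ S → ∃[ C ] IsComponent G (W) C × v ≡ w C
    chosen-from {v} = Equivalence.to (image v)

    S⊆M₂ : ∀ {v} → v ∈ S → v ∈ W
    S⊆M₂ v∈ =
      let (C , isC , v≡) = chosen-from v∈
      in subst (_∈ W) (sym v≡) (IsComponent.contained isC (chosen C isC))

    -- Adjacent vertices of M₂(B) share a component, and a component has only one chosen vertex.
    S-independent : Independent G S
    S-independent {u} {v} u∈ v∈ u~v =
      let (C , isC , u≡) = chosen-from u∈
          (D , isD , v≡) = chosen-from v∈
          u∈C = subst (_∈ C) (sym u≡) (chosen C isC)
          v∈D = subst (_∈ D) (sym v≡) (chosen D isD)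
          v∈C = IsComponent.closed isC u∈C ((S⊆M₂ u∈ , S⊆M₂ v∈ , u~v) ◅ ε)
      in adjacent⇒≢ G u~v (trans u≡ (trans (cong w (component-unique isC isD v∈C v∈D)) (sym v≡)))

    generating⇒dominates : Generating G BX BY → Dominates G S (M)
    generating⇒dominates gen {v} v∈ =
      let (t , t∈ , v~t) = generating⇒M₂-dominates gen v∈
          C = component t ; isC = component-is t∈
      in ∈N≤1⁺ G (inj₂ (w C , Equivalence.from (image (w C)) (C , isC , refl) ,
           maximal-sees ∈F isC (chosen C isC) (maximal C isC) v∈ (∈-component t∈ refl) v~t))

    -- The greedy extension of `S` is one witness for both sides. A vertex that does not touch the
    -- side being tested is either free, or touches exactly the other side and lies in `M`, where
    -- `S` already sees it.
    dominates⇒generating : Dominates G S (M) → Generating G BX BY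
    dominates⇒generating dom = extend (greedy G free? {S} S-independent (λ v∈ → M₂-free (S⊆M₂ v∈)))
      where
      extend : ∃[ T ] S ⊆ T × Independent G T × (∀ {v} → v ∈ T → Free v) × (∀ v → Free v → v ∈ T ⊎ Touches G T v) →
               Generating G BX BY
      extend (T , S⊆T , indT , T-free , T-dom) = T , indT ,
        X.completes indT (λ t∈ → proj₁ (T-free t∈)) seenX ,
        Y.completes indT (λ t∈ → proj₂ (T-free t∈)) seenY
        where
        seen : ∀ {v} → v ∈ M → v ∈ T ⊎ Touches G T v
        seen v∈ = [ (λ v∈S → inj₁ (S⊆T v∈S)) , (λ (s , s∈ , a) → inj₂ (s , S⊆T s∈ , a)) ]′ (∈N≤1⁻ G (dom v∈))
        seenX : ∀ {v} → v ∉ BY → v ∉ BX → ¬ Touches G BX v → v ∈ T ⊎ Touches G T v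
        seenX {v} v∉Y v∉X ¬tX = case touches? G BY v of λ where
          (yes tY) → seen (q⊆p∪q M₁X M₁Y (Equivalence.from ∈M₁Y (tY , ¬tX , v∉X)))
          (no ¬tY) → T-dom v ((v∉X , ¬tX) , (v∉Y , ¬tY))
        seenY : ∀ {v} → v ∉ BX → v ∉ BY → ¬ Touches G BY v → v ∈ T ⊎ Touches G T v
        seenY {v} v∉X v∉Y ¬tY = case touches? G BX v of λ where
          (yes tX) → seen (p⊆p∪q M₁Y (Equivalence.from ∈M₁X (tX , ¬tY , v∉Y)))
          (no ¬tX) → T-dom v ((v∉X , ¬tX) , (v∉Y , ¬tY))

module Paper {n : ℕ} (G : Graph n) {BX BY : Subset n} (B : InducedCompleteBipartite G BX BY) where
  open Graph G
  private
    module X = Characterisation G (swapSides B)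
    module Y = Characterisation G B

  ∈f⁺ : ∀ {v w} → v ∈ M₁ G BX BY × Adj v w → v ∈ f G BX BY w
  ∈f⁺ {v} {w} (v∈M₁ , a) = x∈p∩q⁺ {p = N G 1 ⁅ w ⁆} {M₁ G BX BY}
      (∈N₁⁺ G {⁅ w ⁆} (λ v∈w → adjacent⇒≢ G a (x∈⁅y⁆⇒x≡y w v∈w)) (w , x∈⁅x⁆ w , a) , v∈M₁)

  ∈f⁻ : ∀ {v w} → v ∈ f G BX BY w → v ∈ M₁ G BX BY × Adj v w
  ∈f⁻ {v} {w} v∈ with x∈p∩q⁻ (N G 1 ⁅ w ⁆) (M₁ G BX BY) v∈
  ... | v∈N₁ , v∈M₁ with ∈N₁⁻ G {⁅ w ⁆} v∈N₁
  ...   | _ , s , s∈ , a = v∈M₁ , subst (Adj v) (x∈⁅y⁆⇒x≡y w s∈) a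

  ∈f : ∀ {v w} → v ∈ f G BX BY w ⇔ (v ∈ M₁ G BX BY × Adj v w)
  ∈f = mk⇔ ∈f⁻ ∈f⁺

  generating⇔dominates : Chordal G → ∀ {w S} → ChosenBy G BX BY w S →
    Generating G BX BY ⇔ Dominates G S (M₁ G BX BY)
  generating⇔dominates chordal choice = mk⇔
    (generating⇒dominates ∈f chosen maximal image) (dominates⇒generating ∈f chosen maximal image)
    where
    open ChosenBy choice
    open Generation G chordal B (M₁-of G BY BX) (M₁-of G BX BY) (M₂-of G BY BX BX) (M₂-of G BX BY BY)
      X.∈M₁-of Y.∈M₁-of X.∈M₂-of Y.∈M₂-of

-- Frames and for-loops

update-here : ∀ {A : Set} (g : ℕ → A) i x → update g i x i ≡ x
update-here g i x with i ≡ᵇ i in e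
... | true  = refl
... | false with () ← subst T e (≡⇒≡ᵇ i i refl)

update-else : ∀ {A : Set} (g : ℕ → A) i x {j} → i ≢ j → update g i x j ≡ g j
update-else g i x {j} i≢j with i ≡ᵇ j in e
... | false = refl
... | true  = contradiction (≡ᵇ⇒≡ i j (subst T (sym e) tt)) i≢j

distinct : ∀ i j → T (not (i ≡ᵇ j)) → i ≢ j
distinct i _ t refl with i ≡ᵇ i in e
... | false with () ← subst T e (≡⇒≡ᵇ i i refl)

-- A syntactic condition. For a concrete command and index it evaluates to a product of unit types,
-- which `_` solves.
Untouched : Cmd → ℕ → Set
Untouched (r ≔ e)      a = ⊤
Untouched (put b i e)  a = T (not (b ≡ᵇ a))
Untouched (c ⨾ d)      a = Untouched c a × Untouched d a
Untouched (ifnz e c d) a = Untouched c a × Untouched d a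
Untouched (while e c)  a = Untouched c a

Unassigned : Cmd → ℕ → Set
Unassigned (s ≔ e)      r = T (not (s ≡ᵇ r))
Unassigned (put b i e)  r = ⊤
Unassigned (c ⨾ d)      r = Unassigned c r × Unassigned d r
Unassigned (ifnz e c d) r = Unassigned c r × Unassigned d r
Unassigned (while e c)  r = Unassigned c r

arr-frame : ∀ {c σ τ t a} → c ⊢ σ ⇓ τ [ t ] → Untouched c a → arr τ a ≡ arr σ a
arr-frame assign         _       = refl
arr-frame {put b _ _} {σ} {a = a} store u = update-else (arr σ) b _ (distinct b a u)
arr-frame (seq p q)      (u , v) = trans (arr-frame q v) (arr-frame p u)
arr-frame (if-yes _ p)   (u , _) = arr-frame p u
arr-frame (if-no _ p)    (_ , v) = arr-frame p v
arr-frame (loop _ p q)   u       = trans (arr-frame q u) (arr-frame p u)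
arr-frame (exit _)       _       = refl

reg-frame : ∀ {c σ τ t r} → c ⊢ σ ⇓ τ [ t ] → Unassigned c r → reg τ r ≡ reg σ r
reg-frame {s ≔ _} {σ} {r = r} assign u = update-else (reg σ) s _ (distinct s r u)
reg-frame store          _       = refl
reg-frame (seq p q)      (u , v) = trans (reg-frame q v) (reg-frame p u)
reg-frame (if-yes _ p)   (u , _) = reg-frame p u
reg-frame (if-no _ p)    (_ , v) = reg-frame p v
reg-frame (loop _ p q)   u       = trans (reg-frame q u) (reg-frame p u)
reg-frame (exit _)       _       = refl

-- A Hoare triple for total correctness with a cost bound, at one fixed initial state.
Runs : Cmd → State → ℕ → (State → Set) → Set
Runs c σ K Q = ∃[ τ ] ∃[ t ] (c ⊢ σ ⇓ τ [ t ]) × t ≤ K × Q τ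

-- The continuation receives the derivation itself, so that the frame lemmas can carry facts past
-- `c`.
runs-seq : ∀ {c d σ K L} {Q R : State → Set} → Runs c σ K Q →
           (∀ τ {t} → c ⊢ σ ⇓ τ [ t ] → Q τ → Runs d τ L R) → Runs (c ⨾ d) σ (K + L) R
runs-seq (τ , t , p , t≤K , q) next =
  let (υ , s , p′ , s≤L , r) = next τ p q in υ , t + s , seq p p′ , +-mono-≤ t≤K s≤L , r

runs-weaken : ∀ {c σ K L} {Q : State → Set} → K ≤ L → Runs c σ K Q → Runs c σ L Q
runs-weaken K≤L (τ , t , p , t≤K , q) = τ , t , p , ≤-trans t≤K K≤L , q

runs-assign : ∀ {r e σ} {Q : State → Set} → Q (state (update (reg σ) r (⟦ e ⟧ σ)) (arr σ)) → Runs (r ≔ e) σ 1 Q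
runs-assign q = _ , 1 , assign , ≤-refl , q

runs-store : ∀ {a i e σ} {Q : State → Set} →
             Q (state (reg σ) (update (arr σ) a (update (arr σ a) (⟦ i ⟧ σ) (⟦ e ⟧ σ)))) → Runs (put a i e) σ 1 Q
runs-store q = _ , 1 , store , ≤-refl , q

-- Register 0 holds `n`, so the truncated difference vanishes as soon as `r` has reached `n`.
for : ℕ → Cmd → Cmd
for r c = r ≔ lit 0 ⨾ while (var 0 ⊖ var r) (c ⨾ r ≔ var r ⊕ lit 1)

setReg : State → ℕ → ℕ → State
setReg σ r k = state (update (reg σ) r k) (arr σ)

-- Compares a state during a loop with the one before it. The loop variable `r` is exempt because
-- the loop advances it outside `c`.
record Frame (c : Cmd) (r : ℕ) (σ ρ : State) : Set where
  field
    arrays    : ∀ {a} → Untouched c a → arr ρ a ≡ arr σ a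
    registers : ∀ {s} → Unassigned c s → T (not (r ≡ᵇ s)) → reg ρ s ≡ reg σ s
open Frame public

module _ {n : ℕ} (r : ℕ) (c : Cmd) (K : ℕ) (I : ℕ → State → Set) {σ : State}
  (fix-r : Unassigned c r) (fix-0 : Unassigned c 0) (r≢0 : T (not (r ≡ᵇ 0))) (order : reg σ 0 ≡ n)
  (step : ∀ (u : Fin n) ρ → Frame c r σ ρ → reg ρ r ≡ toℕ u → I (toℕ u) ρ →
          Runs c ρ K (λ τ → I (suc (toℕ u)) (setReg τ r (suc (toℕ u))))) where

  private
    body : Cmd
    body = c ⨾ r ≔ var r ⊕ lit 1

    turn : ∀ i {ρ} → i < n → Frame c r σ ρ → reg ρ r ≡ i → I i ρ →
           Runs body ρ (K + 1) (λ τ → Frame c r σ τ × reg τ r ≡ suc i × I (suc i) τ)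
    turn i {ρ} i<n fr e inv with fromℕ< i<n | toℕ-fromℕ< i<n
    ... | u | refl with step u ρ fr e inv
    ...   | τ , t , p , t≤K , inv′ =
      setReg τ r (reg τ r + 1) , t + 1 , seq p assign , +-monoˡ-≤ 1 t≤K ,
      record
        { arrays    = λ ut → trans (arr-frame p ut) (arrays fr ut)
        ; registers = λ {s} ua r≢s → trans (update-else (reg τ) r _ (distinct r s r≢s))
                        (trans (reg-frame p ua) (registers fr ua r≢s)) } ,
      trans (update-here (reg τ) r _) k≡ , subst (λ k → I (suc (toℕ u)) (setReg τ r k)) (sym k≡) inv′
      where
      k≡ : reg τ r + 1 ≡ suc (toℕ u)
      k≡ = trans (cong (_+ 1) (trans (reg-frame p fix-r) e)) (+-comm (toℕ u) 1)

    remaining : ∀ m i {ρ} → i + m ≡ n → Frame c r σ ρ → reg ρ r ≡ i → I i ρ →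
                Runs (while (var 0 ⊖ var r) body) ρ (m * (K + 2) + 1) (I n)
    remaining zero i {ρ} i≡n fr e inv =
      ρ , 1 , exit test , ≤-refl , subst (λ j → I j ρ) (trans (sym (+-identityʳ i)) i≡n) inv
      where
      test : reg ρ 0 ∸ reg ρ r ≡ 0
      test rewrite registers fr {0} fix-0 r≢0 | order | e | sym i≡n | +-identityʳ i = n∸n≡0 i
    remaining (suc m) i {ρ} i+1+m fr e inv with turn i (subst (i <_) i+1+m (m<m+n i (s≤s z≤n))) fr e inv
    ... | τ , s , p , s≤ , fr′ , e′ , inv′ with remaining m (suc i) (trans (sym (+-suc i m)) i+1+m) fr′ e′ inv′
    ...   | υ , t , q , t≤ , inv″ = υ , suc (s + t) , loop test p q , bound , inv″
      where
      test : reg ρ 0 ∸ reg ρ r ≢ 0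
      test z rewrite registers fr {0} fix-0 r≢0 | order | e | sym i+1+m | m+n∸m≡n i (suc m) with () ← z
      bound : suc (s + t) ≤ K + 2 + m * (K + 2) + 1
      bound = subst (suc (s + t) ≤_) (eq K (m * (K + 2))) (s≤s (+-mono-≤ s≤ t≤))
        where
        eq : ∀ a b → suc (a + 1 + (b + 1)) ≡ a + 2 + b + 1
        eq = solve-∀

  -- Each turn pays `K` for the body, 1 for the test and 1 for the increment. The final 2 is the
  -- initial assignment and the failing test.
  for-rule : I 0 (setReg σ r 0) → Runs (for r c) σ (n * (K + 2) + 2) (I n)
  for-rule inv with remaining n 0 refl
    (record { arrays = λ _ → refl ; registers = λ {s} _ r≢s → update-else (reg σ) r 0 (distinct r s r≢s) })
    (update-here (reg σ) r 0) inv
  ... | τ , t , p , t≤ , q = τ , suc t , seq assign p , subst (suc t ≤_) (sym (+-suc _ 1)) (s≤s t≤) , q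

-- Sums and Boolean expressions

partial : ∀ {n} → (Fin n → ℕ) → ℕ → ℕ
partial         g zero    = 0
partial {zero}  g (suc i) = 0
partial {suc n} g (suc i) = g Fin.zero + partial (g ∘ Fin.suc) i

partial-suc : ∀ {n} (g : Fin n → ℕ) u → partial g (suc (toℕ u)) ≡ partial g (toℕ u) + g u
partial-suc g Fin.zero    = +-comm (g Fin.zero) 0
partial-suc g (Fin.suc u) =
  trans (cong (g Fin.zero +_) (partial-suc (g ∘ Fin.suc) u)) (sym (+-assoc (g Fin.zero) _ _))

total : ∀ {n} → (Fin n → ℕ) → ℕ
total {n} g = partial g n

infixr 6 _∧ₑ_
infixr 5 _∨ₑ_
-- Truncated subtraction is complementation on 0 and 1. Its double application sends every positive
-- number to 1, and conjunction follows by De Morgan.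
¬ₑ_ pos : Expr → Expr
¬ₑ e = lit 1 ⊖ e
pos e = ¬ₑ ¬ₑ e
_∧ₑ_ _∨ₑ_ _==ₑ_ _<ₑ_ : Expr → Expr → Expr
d ∧ₑ e = ¬ₑ (¬ₑ d ⊕ ¬ₑ e)
d ∨ₑ e = pos (d ⊕ e)
d ==ₑ e = ¬ₑ ((d ⊖ e) ⊕ (e ⊖ d))
d <ₑ e = pos (e ⊖ d)

elem : ℕ → List ℕ → Bool
elem a []       = false
elem a (b ∷ bs) = (b ≡ᵇ a) ∨ elem a bs

fill : ℕ → Cmd → Expr → Cmd
fill out c e = for 3 (c ⨾ put out (var 3) e)

-- Register 5 is advanced but never reset here: over the rows of an outer loop it runs through all
-- offsets `u * n + v`.
sumOver : Expr → Cmd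
sumOver e = 6 ≔ lit 0 ⨾ for 4 (6 ≔ var 6 ⊕ e ⨾ 5 ≔ var 5 ⊕ lit 1)

-- Passes that fill one array

module Tables {n : ℕ} (x : Fin n) (Spec : ℕ → (ℕ → ℕ) → Set) where

  -- `D` lists the arrays whose contents are established. Membership is Boolean, so that for a
  -- concrete list it is settled by evaluation.
  record Known (D : List ℕ) (σ : State) : Set where
    field
      order  : reg σ 0 ≡ n
      centre : reg σ 1 ≡ toℕ x
      spec   : ∀ a {_ : T (elem a D)} → Spec a (arr σ a)
  open Known public

  known-frame : ∀ {D σ τ} → Known D σ → reg τ 0 ≡ reg σ 0 → reg τ 1 ≡ reg σ 1 →
                (∀ a → T (elem a D) → arr τ a ≡ arr σ a) → Known D τ
  known-frame k r₀ r₁ same = record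
    { order  = trans r₀ (order k)
    ; centre = trans r₁ (centre k)
    ; spec   = λ a {a∈} → subst (Spec a) (sym (same a a∈)) (spec k a {a∈}) }

  known-add : ∀ {D σ b} → Known D σ → Spec b (arr σ b) → Known (b ∷ D) σ
  known-add {D} {σ} {b} k s = record { order = order k ; centre = centre k ; spec = spec′ }
    where
    spec′ : ∀ a {_ : T (elem a (b ∷ D))} → Spec a (arr σ a)
    spec′ a {a∈} with b ≡ᵇ a in e
    ... | true  = subst (λ c → Spec c (arr σ c)) (≡ᵇ⇒≡ b a (subst T (sym e) tt)) s
    ... | false = spec k a {a∈}

  separate : ∀ {a b} D → T (elem a D) → T (not (elem b D)) → T (not (b ≡ᵇ a))
  separate {a} {b} (c ∷ D) a∈ b∉ with c ≡ᵇ b in e | c ≡ᵇ a in e′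
  ... | false | false = separate D a∈ b∉
  ... | false | true with b ≡ᵇ a in e″
  ...   | false = tt
  ...   | true with () ← trans (sym e) (trans (cong (c ≡ᵇ_) (≡ᵇ⇒≡ b a (subst T (sym e″) tt))) e′)

  -- `J` is what the pass maintains about register 5: trivial for pointwise passes, `k ≡ i * n` for
  -- tables. `done` bridges to `Spec out`, which does not reduce while `out` is a variable.
  fill-rule : ∀ {D σ} out c e K (F : Fin n → ℕ) (J : ℕ → ℕ → Set) →
    T (not (elem out D)) → (∀ {a} → Untouched c a) → Unassigned c 0 → Unassigned c 1 → Unassigned c 3 →
    Known D σ →
    (∀ u ρ → Known D ρ → reg ρ 3 ≡ toℕ u → J (toℕ u) (reg ρ 5) →
       Runs c ρ K (λ τ → ⟦ e ⟧ τ ≡ F u × J (suc (toℕ u)) (reg τ 5))) →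
    (∀ g → (∀ u → g (toℕ u) ≡ F u) → Spec out g) → J 0 (reg σ 5) →
    Runs (fill out c e) σ (n * (K + 1 + 2) + 2) (Known (out ∷ D))
  fill-rule {D} {σ} out c e K F J out∉ ut ua₀ ua₁ ua₃ known run done j₀
    with for-rule {n} 3 (c ⨾ put out (var 3) e) (K + 1)
      (λ i ρ → (∀ u → toℕ u < i → arr ρ out (toℕ u) ≡ F u) × J i (reg ρ 5))
      (ua₃ , tt) (ua₀ , tt) tt (order known) step ((λ _ ()) , j₀)
    where
    step : ∀ (u : Fin n) ρ → Frame (c ⨾ put out (var 3) e) 3 σ ρ → reg ρ 3 ≡ toℕ u →
      (∀ v → toℕ v < toℕ u → arr ρ out (toℕ v) ≡ F v) × J (toℕ u) (reg ρ 5) →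
      Runs (c ⨾ put out (var 3) e) ρ (K + 1) (λ τ →
        (∀ v → toℕ v < suc (toℕ u) → arr τ out (toℕ v) ≡ F v) × J (suc (toℕ u)) (reg τ 5))
    step u ρ fr r₃ (below , j) = runs-seq
      (run u ρ (known-frame known (registers fr (ua₀ , tt) tt) (registers fr (ua₁ , tt) tt)
                 (λ a a∈ → arrays fr (ut , separate D a∈ out∉))) r₃ j)
      λ τ p (e≡ , j′) → runs-store (written τ p e≡ , j′)
      where
      written : ∀ τ {t} → c ⊢ ρ ⇓ τ [ t ] → ⟦ e ⟧ τ ≡ F u → ∀ v → toℕ v < suc (toℕ u) →
        update (arr τ) out (update (arr τ out) (reg τ 3) (⟦ e ⟧ τ)) out (toℕ v) ≡ F v
      written τ p e≡ v v≤u rewrite update-here (arr τ) out (update (arr τ out) (reg τ 3) (⟦ e ⟧ τ))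
        | trans (reg-frame p ua₃) r₃ with m≤n⇒m<n∨m≡n (≤-pred v≤u)
      ... | inj₁ v<u = trans (update-else (arr τ out) (toℕ u) _ (≢-sym (<⇒≢ v<u)))
                         (trans (cong (λ g → g (toℕ v)) (arr-frame p ut)) (below v v<u))
      ... | inj₂ v≡u rewrite toℕ-injective v≡u = trans (update-here (arr τ out) (toℕ u) _) e≡
  ... | τ , t , p , t≤ , (values , _) = τ , t , p , t≤ ,
    known-add (known-frame known (reg-frame p (tt , (ua₀ , tt) , tt)) (reg-frame p (tt , (ua₁ , tt) , tt))
                (λ a a∈ → arr-frame p (tt , (ut , separate D a∈ out∉) , tt)))
              (done _ λ u → values u (toℕ<n u))

  sum-rule : ∀ {D σ} e (F : Fin n → ℕ) → Known D σ →
    (∀ v ρ → Known D ρ → reg ρ 3 ≡ reg σ 3 → reg ρ 4 ≡ toℕ v → reg ρ 5 ≡ reg σ 5 + toℕ v → ⟦ e ⟧ ρ ≡ F v) →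
    Runs (sumOver e) σ (1 + (n * 4 + 2)) (λ τ → reg τ 6 ≡ total F × reg τ 5 ≡ reg σ 5 + n)
  sum-rule {D} {σ} e F known value = runs-seq {K = 1} {L = n * 4 + 2}
    (runs-assign {Q = λ τ → τ ≡ setReg σ 6 0} refl)
    λ { _ _ refl → for-rule {n} 4 (6 ≔ var 6 ⊕ e ⨾ 5 ≔ var 5 ⊕ lit 1) 2
          (λ i ρ → reg ρ 6 ≡ partial F i × reg ρ 5 ≡ reg σ 5 + i)
          _ _ _ (order known) step (refl , sym (+-identityʳ _)) }
    where
    step : ∀ (v : Fin n) ρ → Frame (6 ≔ var 6 ⊕ e ⨾ 5 ≔ var 5 ⊕ lit 1) 4 (setReg σ 6 0) ρ → reg ρ 4 ≡ toℕ v →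
      reg ρ 6 ≡ partial F (toℕ v) × reg ρ 5 ≡ reg σ 5 + toℕ v →
      Runs (6 ≔ var 6 ⊕ e ⨾ 5 ≔ var 5 ⊕ lit 1) ρ 2 (λ τ →
        reg τ 6 ≡ partial F (suc (toℕ v)) × reg τ 5 ≡ reg σ 5 + suc (toℕ v))
    step v ρ fr r₄ (r₆ , r₅) = _ , 2 , seq assign assign , ≤-refl ,
      trans (cong₂ _+_ r₆ (value v ρ known′ (registers fr _ _) r₄ r₅)) (sym (partial-suc F v)) ,
      trans (cong (_+ 1) r₅) (trans (+-assoc (reg σ 5) _ 1) (cong (reg σ 5 +_) (+-comm _ 1)))
      where
      known′ : Known D ρ
      known′ = known-frame known (registers fr _ _) (registers fr _ _) (λ a _ → arrays fr _)

-- The program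

-- ⟦_⟧ reduces, so an expression can be inferred only from an index of a record.
record Yields (ρ : State) (e : Expr) (k : ℕ) : Set where
  constructor yields
  field number : ⟦ e ⟧ ρ ≡ k

record Tests (ρ : State) (e : Expr) (b : Bool) : Set where
  constructor tests
  field truth : ⟦ e ⟧ ρ ≡ bit b
open Tests public

module _ {ρ : State} where

  ¬-test : ∀ {e b} → Tests ρ e b → Tests ρ (¬ₑ e) (not b)
  ¬-test {b = false} (tests p) = tests (cong (1 ∸_) p)
  ¬-test {b = true}  (tests p) = tests (cong (1 ∸_) p)

  ∧-test : ∀ {d e b c} → Tests ρ d b → Tests ρ e c → Tests ρ (d ∧ₑ e) (b ∧ c)
  ∧-test {b = b} {c} (tests p) (tests q) =
    tests (trans (cong₂ (λ i j → 1 ∸ ((1 ∸ i) + (1 ∸ j))) p q) (table b c))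
    where
    table : ∀ b c → 1 ∸ ((1 ∸ bit b) + (1 ∸ bit c)) ≡ bit (b ∧ c)
    table false false = refl
    table false true  = refl
    table true  false = refl
    table true  true  = refl

  ∨-test : ∀ {d e b c} → Tests ρ d b → Tests ρ e c → Tests ρ (d ∨ₑ e) (b ∨ c)
  ∨-test {b = b} {c} (tests p) (tests q) =
    tests (trans (cong₂ (λ i j → 1 ∸ (1 ∸ (i + j))) p q) (table b c))
    where
    table : ∀ b c → 1 ∸ (1 ∸ (bit b + bit c)) ≡ bit (b ∨ c)
    table false false = refl
    table false true  = refl
    table true  false = refl
    table true  true  = refl

  <-test : ∀ {d e a b} → Yields ρ d a → Yields ρ e b → Tests ρ (d <ₑ e) (a <ᵇ b)
  <-test {a = a} {b} (yields p) (yields q) =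
    tests (trans (cong₂ (λ i j → 1 ∸ (1 ∸ (j ∸ i))) p q) (compare a b))
    where
    compare : ∀ a b → 1 ∸ (1 ∸ (b ∸ a)) ≡ bit (a <ᵇ b)
    compare zero    zero    = refl
    compare zero    (suc b) = cong (1 ∸_) (0∸n≡0 b)
    compare (suc a) zero    = refl
    compare (suc a) (suc b) = compare a b

  ==-test : ∀ {d e a b} → Yields ρ d a → Yields ρ e b → Tests ρ (d ==ₑ e) (a ≡ᵇ b)
  ==-test {a = a} {b} (yields p) (yields q) =
    tests (trans (cong₂ (λ i j → 1 ∸ ((i ∸ j) + (j ∸ i))) p q) (compare a b))
    where
    compare : ∀ a b → 1 ∸ ((a ∸ b) + (b ∸ a)) ≡ bit (a ≡ᵇ b)
    compare zero    zero    = refl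
    compare zero    (suc b) = 0∸n≡0 b
    compare (suc a) zero    = 0∸n≡0 (a + 0)
    compare (suc a) (suc b) = compare a b

  pos-test : ∀ {e k} → Yields ρ e k → Tests ρ (pos e) (0 <ᵇ k)
  pos-test {k = k} (yields p) = tests (trans (cong (λ i → 1 ∸ (1 ∸ i)) p) (sign k))
    where
    sign : ∀ k → 1 ∸ (1 ∸ k) ≡ bit (0 <ᵇ k)
    sign zero    = refl
    sign (suc k) = cong (1 ∸_) (0∸n≡0 k)

  look : ∀ {a i n} {g : Fin n → ℕ} {v} → (∀ v → arr ρ a (toℕ v) ≡ g v) → reg ρ i ≡ toℕ v → Yields ρ (get a (var i)) (g v)
  look {a} {v = v} s r = yields (trans (cong (arr ρ a) r) (s v))

  lookBit : ∀ {a i n} {P : Subset n} {v} → (∀ v → arr ρ a (toℕ v) ≡ bit (lookup P v)) → reg ρ i ≡ toℕ v →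
            Tests ρ (get a (var i)) (lookup P v)
  lookBit {a} {v = v} s r = tests (trans (cong (arr ρ a) r) (s v))

-- Registers: 0 is n, 1 is x, 2 the answer, 3 and 4 the loop variables u and v, 5 the offset
-- u * n + v, 6 an accumulator, 7 a label, 8 a dummy.
-- Arrays 0 to 6 are as in Input and Output; 7 holds {x}; 8 and 9 count neighbours in {x} and
-- B_Y; 10 and 11 hold M₁(B_X) and M₁(B_Y); 12 and 13 count neighbours in these; 14 marks labels;
-- 15 counts better vertices in the same component; 16 counts neighbours in S.

-- The assignment to register 6 is a filler body, as `Cmd` has no skip.
pointwise : ℕ → Expr → Cmd
pointwise out e = fill out (6 ≔ lit 0) e

table : ℕ → Expr → Cmd
table out e = 5 ≔ lit 0 ⨾ fill out (sumOver e) (var 6)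

atU atV : ℕ → Expr
atU a = get a (var 3)
atV a = get a (var 4)

neighbourIn : ℕ → Expr
neighbourIn a = atV a ∧ₑ get 0 (var 5)

linked : Expr
linked = atU 3 ∧ₑ atV 3 ∧ₑ get 0 (var 5)

-- Marks are indexed by label: one scan of a row marks all classes to be merged and one more
-- rewrites them, so each vertex costs O(n). Initial memory is arbitrary, so the cells of the
-- current labels are cleared beforehand.
clearMarks markLabels mergeMarked absorb components : Cmd
clearMarks  = for 4 (put 14 (atV 4) (lit 0))
markLabels  = for 4 (put 14 (atV 4) (get 14 (atV 4) ⊕ linked) ⨾ 5 ≔ var 5 ⊕ lit 1)
mergeMarked = for 4 (ifnz (get 14 (atV 4)) (put 4 (var 4) (var 7)) (8 ≔ lit 0))
absorb      = 7 ≔ atU 4 ⨾ clearMarks ⨾ markLabels ⨾ mergeMarked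
components  = for 3 (put 4 (var 3) (var 3)) ⨾ 5 ≔ lit 0 ⨾ for 3 absorb

m₁x m₁y m₂ better selected undominated : Expr
m₁x = pos (atU 8) ∧ₑ ¬ₑ pos (atU 9) ∧ₑ ¬ₑ atU 1
m₁y = pos (atU 9) ∧ₑ ¬ₑ pos (atU 8) ∧ₑ ¬ₑ atU 7
m₂  = (pos (atU 12) ∧ₑ ¬ₑ pos (atU 8) ∧ₑ ¬ₑ atU 7) ∨ₑ (pos (atU 13) ∧ₑ ¬ₑ pos (atU 9) ∧ₑ ¬ₑ atU 1)
better = atV 3 ∧ₑ (atV 4 ==ₑ atU 4) ∧ₑ ((atU 5 <ₑ atV 5) ∨ₑ ((atU 5 ==ₑ atV 5) ∧ₑ (var 4 <ₑ var 3)))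
selected = atU 3 ∧ₑ ¬ₑ pos (atU 15)
undominated = atV 2 ∧ₑ ¬ₑ atV 6 ∧ₑ ¬ₑ pos (atV 16)

preparation program : Cmd
preparation =
  pointwise 7 (var 3 ==ₑ var 1) ⨾ table 8 (neighbourIn 7) ⨾ table 9 (neighbourIn 1) ⨾
  pointwise 10 m₁x ⨾ pointwise 11 m₁y ⨾ pointwise 2 (atU 10 ∨ₑ atU 11) ⨾
  table 12 (neighbourIn 10) ⨾ table 13 (neighbourIn 11) ⨾ pointwise 3 m₂ ⨾
  table 5 (neighbourIn 2) ⨾ components ⨾
  table 15 better ⨾ pointwise 6 selected ⨾ table 16 (neighbourIn 6)
program = preparation ⨾ sumOver undominated ⨾ 2 ≔ ¬ₑ var 6

-- The latest array comes first. Array 14 is absent, being scratch space.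
finished : List ℕ
finished = 16 ∷ 6 ∷ 15 ∷ 4 ∷ 5 ∷ 3 ∷ 13 ∷ 12 ∷ 2 ∷ 11 ∷ 10 ∷ 9 ∷ 8 ∷ 7 ∷ 0 ∷ 1 ∷ []

-- Only the Boolean equations between the sets matter here, not their graph-theoretic meaning.
module Execution {n : ℕ} (G : Graph n) (x : Fin n) (BY M₁X M₁Y M W : Subset n) where
  open Graph G
  open Labelling G W

  count : Subset n → Fin n → ℕ
  count S u = total λ v → bit (lookup S v ∧ adj u v)

  touchesᵇ : Subset n → Fin n → Bool
  touchesᵇ S u = 0 <ᵇ count S u

  beats : Fin n → Fin n → Bool
  beats v u = lookup W v ∧ (label v ≡ᵇ label u) ∧
    ((count M u <ᵇ count M v) ∨ ((count M u ≡ᵇ count M v) ∧ (toℕ v <ᵇ toℕ u)))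

  beaten : Fin n → ℕ
  beaten u = total λ v → bit (beats v u)

  S : Subset n
  S = tabulate λ u → lookup W u ∧ not (0 <ᵇ beaten u)

  missed : Fin n → Bool
  missed v = lookup M v ∧ not (lookup S v) ∧ not (touchesᵇ S v)

  Bits : Subset n → (ℕ → ℕ) → Set
  Bits P g = ∀ v → g (toℕ v) ≡ bit (lookup P v)

  Spec : ℕ → (ℕ → ℕ) → Set
  Spec 0  g = ∀ u v → g (toℕ u * n + toℕ v) ≡ bit (adj u v)
  Spec 1  g = Bits BY g
  Spec 2  g = Bits M g
  Spec 3  g = Bits W g
  Spec 4  g = ∀ v → g (toℕ v) ≡ label v
  Spec 5  g = ∀ v → g (toℕ v) ≡ count M v
  Spec 6  g = Bits S g
  Spec 7  g = Bits ⁅ x ⁆ g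
  Spec 8  g = ∀ v → g (toℕ v) ≡ count ⁅ x ⁆ v
  Spec 9  g = ∀ v → g (toℕ v) ≡ count BY v
  Spec 10 g = Bits M₁X g
  Spec 11 g = Bits M₁Y g
  Spec 12 g = ∀ v → g (toℕ v) ≡ count M₁X v
  Spec 13 g = ∀ v → g (toℕ v) ≡ count M₁Y v
  Spec 15 g = ∀ v → g (toℕ v) ≡ beaten v
  Spec 16 g = ∀ v → g (toℕ v) ≡ count S v
  Spec _  g = ⊤

  open Tables x Spec public

  -- Every cost is brought to the form `k * (n * n)`, so that sequencing just adds the constants.
  record Phase (D : List ℕ) (c : Cmd) (k : ℕ) (E : List ℕ) : Set where
    constructor phase
    field run : ∀ {σ} → Known D σ → Runs c σ (k * (n * n)) (Known E)
  open Phase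

  infixr 4 _then_
  _then_ : ∀ {D E F c d k l} → Phase D c k E → Phase E d l F → Phase D (c ⨾ d) (k + l) F
  _then_ {k = k} {l} p q = phase λ known →
    runs-weaken (≤-reflexive (sym (*-distribʳ-+ (n * n) k l))) (runs-seq (run p known) λ τ _ known′ → run q known′)

  private
    instance
      nonZero : NonZero n
      nonZero = nonZeroIndex x

  -- n ≥ 1, so lower-order terms are absorbed by n².
  quadratic : ∀ a b c → a * (n * n) + b * n + c ≤ (a + b + c) * (n * n)
  quadratic a b c = ≤-trans
    (+-mono-≤ (+-monoʳ-≤ (a * (n * n)) (*-monoʳ-≤ b (m≤m*n n n)))
      (≤-trans (≤-reflexive (sym (*-identityʳ c))) (*-monoʳ-≤ c (≤-trans (>-nonZero⁻¹ n) (m≤m*n n n)))))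
    (≤-reflexive (sym (trans (*-distribʳ-+ (n * n) (a + b) c) (cong (_+ c * (n * n)) (*-distribʳ-+ (n * n) a b)))))

  pointwise-phase : ∀ {D} out e (F : Fin n → ℕ) → {T (not (elem out D))} →
    (∀ g → (∀ u → g (toℕ u) ≡ F u) → Spec out g) →
    (∀ u ρ → Known D ρ → reg ρ 3 ≡ toℕ u → ⟦ e ⟧ ρ ≡ F u) →
    Phase D (pointwise out e) 6 (out ∷ D)
  pointwise-phase out e F {out∉} done value = phase λ known → runs-weaken
    (≤-trans (≤-reflexive (cong (_+ 2) (*-comm n 4))) (quadratic 0 4 2))
    (fill-rule out (6 ≔ lit 0) e 1 F (λ _ _ → ⊤) out∉ _ _ _ _ known
      (λ u ρ k r₃ _ → runs-assign (value u (setReg ρ 6 0) (known-frame k refl refl λ _ _ → refl) r₃ , _))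
      done _)

  table-phase : ∀ {D} out e (F : Fin n → Fin n → ℕ) → {T (not (elem out D))} →
    (∀ g → (∀ u → g (toℕ u) ≡ total (F u)) → Spec out g) →
    (∀ u v ρ → Known D ρ → reg ρ 3 ≡ toℕ u → reg ρ 4 ≡ toℕ v → reg ρ 5 ≡ toℕ u * n + toℕ v → ⟦ e ⟧ ρ ≡ F u v) →
    Phase D (table out e) 13 (out ∷ D)
  table-phase {D} out e F {out∉} done value = phase λ {σ} known → runs-weaken bound
    (runs-seq {K = 1} (runs-assign {Q = λ τ → τ ≡ setReg σ 5 0} refl) λ { _ _ refl →
      fill-rule out (sumOver e) (var 6) (1 + (n * 4 + 2)) (λ u → total (F u)) (λ i k → k ≡ i * n) out∉ _ _ _ _
        (known-frame known refl refl λ _ _ → refl)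
        (λ u ρ k r₃ r₅ → let (τ , t , p , t≤ , s≡ , r₅′) = sum-rule e (F u) k
                               (λ v ρ′ k′ r₃′ r₄ r₅′ → value u v ρ′ k′ (trans r₃′ r₃) r₄ (trans r₅′ (cong (_+ toℕ v) r₅)))
                         in τ , t , p , t≤ , s≡ , trans r₅′ (trans (cong (_+ n) r₅) (+-comm (toℕ u * n) n)))
        done refl })
    where
    bound : 1 + (n * (1 + (n * 4 + 2) + 1 + 2) + 2) ≤ 13 * (n * n)
    bound = ≤-trans (≤-reflexive (eq n)) (quadratic 4 6 3)
      where
      eq : ∀ m → 1 + (m * (1 + (m * 4 + 2) + 1 + 2) + 2) ≡ 4 * (m * m) + 6 * m + 3
      eq = solve-∀

  -- Label merging on the machine

  Labelled : (Fin n → ℕ) → State → Set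
  Labelled l ρ = ∀ v → arr ρ 4 (toℕ v) ≡ l v

  module Absorb {D : List ℕ} (has₀ : T (elem 0 D)) (has₃ : T (elem 3 D))
    (no₄ : T (not (elem 4 D))) (no₁₄ : T (not (elem 14 D)))
    (u : Fin n) (l : Fin n → ℕ) {σ : State} (known : Known D σ)
    (r₃ : reg σ 3 ≡ toℕ u) (r₅ : reg σ 5 ≡ toℕ u * n) (labelled : Labelled l σ) where

    Linked : Fin n → Set
    Linked b = u ∈ W × b ∈ W × Adj u b

    linkᵇ : Fin n → Bool
    linkᵇ b = lookup W u ∧ lookup W b ∧ adj u b

    linkᵇ⁻ : ∀ b → linkᵇ b ≡ true → Linked b
    linkᵇ⁻ b e with lookup W u in eᵤ | lookup W b in eᵦ | adj u b
    ... | true | true | true = lookup⇒[]= u W eᵤ , lookup⇒[]= b W eᵦ , tt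

    linkᵇ⁺ : ∀ b → linkᵇ b ≡ false → ¬ Linked b
    linkᵇ⁺ b e (u∈ , b∈ , a) rewrite []=⇒lookup u∈ | []=⇒lookup b∈ = subst T e a

    record Shared (ρ : State) : Set where
      field
        still   : Known D ρ
        centre₃ : reg ρ 3 ≡ toℕ u
        label₇  : reg ρ 7 ≡ l u
    open Shared

    evolve : ∀ {c ρ τ} → (∀ a → T (elem a D) → Untouched c a) → Frame c 4 ρ τ →
             Unassigned c 0 → Unassigned c 1 → Unassigned c 3 → Unassigned c 7 → Shared ρ → Shared τ
    evolve ut fr u₀ u₁ u₃ u₇ s = record
      { still   = known-frame (still s) (registers fr u₀ tt) (registers fr u₁ tt) (λ a a∈ → arrays fr (ut a a∈))
      ; centre₃ = trans (registers fr u₃ tt) (centre₃ s)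
      ; label₇  = trans (registers fr u₇ tt) (label₇ s) }

    finish : ∀ {c ρ τ t} → (∀ a → T (elem a D) → Untouched c a) → c ⊢ ρ ⇓ τ [ t ] →
             Unassigned c 0 → Unassigned c 1 → Unassigned c 3 → Unassigned c 7 → Shared ρ → Shared τ
    finish ut p u₀ u₁ u₃ u₇ s = record
      { still   = known-frame (still s) (reg-frame p u₀) (reg-frame p u₁) (λ a a∈ → arr-frame p (ut a a∈))
      ; centre₃ = trans (reg-frame p u₃) (centre₃ s)
      ; label₇  = trans (reg-frame p u₇) (label₇ s) }

    clear-run : ∀ {ρ} → Shared ρ → Labelled l ρ →
      Runs clearMarks ρ (n * 3 + 2) (λ τ → ∀ v → arr τ 14 (l v) ≡ 0)
    clear-run {ρ} sh lab with for-rule {n} 4 (put 14 (atV 4) (lit 0)) 1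
        (λ i τ → ∀ v → toℕ v < i → arr τ 14 (l v) ≡ 0) _ _ _ (order (still sh)) step (λ _ ())
      where
      step : ∀ (b : Fin n) τ → Frame (put 14 (atV 4) (lit 0)) 4 ρ τ → reg τ 4 ≡ toℕ b →
        (∀ v → toℕ v < toℕ b → arr τ 14 (l v) ≡ 0) →
        Runs (put 14 (atV 4) (lit 0)) τ 1 (λ υ → ∀ v → toℕ v < suc (toℕ b) → arr υ 14 (l v) ≡ 0)
      step b τ fr r₄ below = runs-store cleared
        where
        here : arr τ 4 (reg τ 4) ≡ l b
        here = trans (cong (arr τ 4) r₄) (trans (cong (λ g → g (toℕ b)) (arrays fr _)) (lab b))
        cleared : ∀ v → toℕ v < suc (toℕ b) → update (arr τ 14) (arr τ 4 (reg τ 4)) 0 (l v) ≡ 0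
        cleared v v≤b rewrite here with l b ≟ l v
        ... | yes e rewrite e = update-here (arr τ 14) (l v) 0
        ... | no ne with m≤n⇒m<n∨m≡n (≤-pred v≤b)
        ...   | inj₁ v<b = trans (update-else (arr τ 14) (l b) 0 ne) (below v v<b)
        ...   | inj₂ v≡b = contradiction (cong l (toℕ-injective (sym v≡b))) ne
    ... | τ , t , p , t≤ , done = τ , t , p , t≤ , λ v → done v (toℕ<n v)

    -- An empty cell speaks only of the neighbours scanned so far, whereas a nonzero cell already
    -- proves `Merged`. Once the row is exhausted the cells decide `Merged`.
    Marked : ℕ → State → Set
    Marked i τ = ∀ v →
      (arr τ 14 (l v) ≡ 0 × (∀ b → toℕ b < i → Linked b → l b ≢ l v)) ⊎
      (arr τ 14 (l v) ≢ 0 × Merged u l v)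

    mark-run : ∀ {ρ} → Shared ρ → Labelled l ρ → reg ρ 5 ≡ toℕ u * n → (∀ v → arr ρ 14 (l v) ≡ 0) →
      Runs markLabels ρ (n * 4 + 2) (λ τ → Marked n τ × reg τ 5 ≡ toℕ u * n + n)
    mark-run {ρ} sh lab r₅ zeros = for-rule {n} 4 body 2
        (λ i τ → Marked i τ × reg τ 5 ≡ toℕ u * n + i) _ _ _ (order (still sh)) step
        ((λ v → inj₁ (zeros v , λ _ ())) , trans r₅ (sym (+-identityʳ _)))
      where
      body : Cmd
      body = put 14 (atV 4) (get 14 (atV 4) ⊕ linked) ⨾ 5 ≔ var 5 ⊕ lit 1
      step : ∀ (b : Fin n) τ → Frame body 4 ρ τ → reg τ 4 ≡ toℕ b → Marked (toℕ b) τ × reg τ 5 ≡ toℕ u * n + toℕ b →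
        Runs body τ 2 (λ υ → Marked (suc (toℕ b)) υ × reg υ 5 ≡ toℕ u * n + suc (toℕ b))
      step b τ fr r₄ (marked , r₅′) = _ , 2 , seq store assign , ≤-refl , marked′ ,
        trans (cong (_+ 1) r₅′) (trans (+-assoc (toℕ u * n) _ 1) (cong (toℕ u * n +_) (+-comm _ 1)))
        where
        sh′ : Shared τ
        sh′ = evolve (λ a a∈ → separate D a∈ no₁₄ , tt) fr _ _ _ _ sh
        here : arr τ 4 (reg τ 4) ≡ l b
        here = trans (cong (arr τ 4) r₄) (trans (cong (λ g → g (toℕ b)) (arrays fr _)) (lab b))
        link : ⟦ linked ⟧ τ ≡ bit (linkᵇ b)
        link = truth {τ} {linked} (∧-test (lookBit {P = W} (spec (still sh′) 3 {has₃}) (centre₃ sh′))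
          (∧-test (lookBit {P = W} (spec (still sh′) 3 {has₃}) r₄)
            (tests (trans (cong (arr τ 0) r₅′) (spec (still sh′) 0 {has₀} u b)))))
        marked′ : ∀ v →
          (update (arr τ 14) (arr τ 4 (reg τ 4)) (arr τ 14 (arr τ 4 (reg τ 4)) + ⟦ linked ⟧ τ) (l v) ≡ 0 ×
             (∀ c → toℕ c < suc (toℕ b) → Linked c → l c ≢ l v)) ⊎
          (update (arr τ 14) (arr τ 4 (reg τ 4)) (arr τ 14 (arr τ 4 (reg τ 4)) + ⟦ linked ⟧ τ) (l v) ≢ 0 × Merged u l v)
        marked′ v rewrite here | link with l b ≟ l v
        ... | no ne rewrite update-else (arr τ 14) (l b) (arr τ 14 (l b) + bit (linkᵇ b)) ne with marked v
        ...   | inj₂ m = inj₂ m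
        ...   | inj₁ (z , none) = inj₁ (z , none′)
          where
          none′ : ∀ c → toℕ c < suc (toℕ b) → Linked c → l c ≢ l v
          none′ c c≤b lk with m≤n⇒m<n∨m≡n (≤-pred c≤b)
          ... | inj₁ c<b = none c c<b lk
          ... | inj₂ c≡b rewrite toℕ-injective c≡b = ne
        marked′ v | yes e rewrite e | update-here (arr τ 14) (l v) (arr τ 14 (l v) + bit (linkᵇ b))
          with marked v | linkᵇ b in eₗ
        ...   | inj₂ (nz , m) | _ = inj₂ ((λ z → nz (m+n≡0⇒m≡0 _ z)) , m)
        ...   | inj₁ (z , none) | true = inj₂ ((λ z′ → case m+n≡0⇒n≡0 (arr τ 14 (l v)) z′ of λ ()) , b , linkᵇ⁻ b eₗ , e)
        ...   | inj₁ (z , none) | false = inj₁ (trans (+-identityʳ _) z , none′)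
          where
          none′ : ∀ c → toℕ c < suc (toℕ b) → Linked c → l c ≢ l v
          none′ c c≤b lk with m≤n⇒m<n∨m≡n (≤-pred c≤b)
          ... | inj₁ c<b = none c c<b lk
          ... | inj₂ c≡b rewrite toℕ-injective c≡b = contradiction lk (linkᵇ⁺ b eₗ)

    merge-run : ∀ {ρ} → Shared ρ → Labelled l ρ → Marked n ρ →
      Runs mergeMarked ρ (n * 4 + 2) (Labelled (relabel u l))
    merge-run {ρ} sh lab marked with for-rule {n} 4 body 2
        -- Array 4 is rewritten while it is being read. The entry of the current vertex is still old
        -- when its mark is looked up, so marks are addressed by the old labels throughout.
        (λ i τ → ∀ v → (toℕ v < i → arr τ 4 (toℕ v) ≡ relabel u l v) × (i ≤ toℕ v → arr τ 4 (toℕ v) ≡ l v))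
        _ _ _ (order (still sh)) step (λ v → (λ ()) , λ _ → lab v)
      where
      body : Cmd
      body = ifnz (get 14 (atV 4)) (put 4 (var 4) (var 7)) (8 ≔ lit 0)
      step : ∀ (b : Fin n) τ → Frame body 4 ρ τ → reg τ 4 ≡ toℕ b →
        (∀ v → (toℕ v < toℕ b → arr τ 4 (toℕ v) ≡ relabel u l v) × (toℕ b ≤ toℕ v → arr τ 4 (toℕ v) ≡ l v)) →
        Runs body τ 2 (λ υ → ∀ v →
          (toℕ v < suc (toℕ b) → arr υ 4 (toℕ v) ≡ relabel u l v) × (suc (toℕ b) ≤ toℕ v → arr υ 4 (toℕ v) ≡ l v))
      step b τ fr r₄ inv = by (marked b)
        where
        here : arr τ 14 (arr τ 4 (reg τ 4)) ≡ arr ρ 14 (l b)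
        here = trans (cong (arr τ 14) (trans (cong (arr τ 4) r₄) (proj₂ (inv b) ≤-refl)))
                     (cong (λ g → g (l b)) (arrays fr _))
        by : (arr ρ 14 (l b) ≡ 0 × (∀ c → toℕ c < n → Linked c → l c ≢ l b)) ⊎ (arr ρ 14 (l b) ≢ 0 × Merged u l b) →
          Runs body τ 2 (λ υ → ∀ v →
          (toℕ v < suc (toℕ b) → arr υ 4 (toℕ v) ≡ relabel u l v) × (suc (toℕ b) ≤ toℕ v → arr υ 4 (toℕ v) ≡ l v))
        by (inj₁ (z , none)) = _ , 2 , if-no (trans here z) assign , ≤-refl , λ v → upto v , λ b<v → proj₂ (inv v) (<⇒≤ b<v)
          where
          upto : ∀ v → toℕ v < suc (toℕ b) → arr τ 4 (toℕ v) ≡ relabel u l v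
          upto v v≤b with m≤n⇒m<n∨m≡n (≤-pred v≤b)
          ... | inj₁ v<b = proj₁ (inv v) v<b
          ... | inj₂ v≡b rewrite toℕ-injective v≡b = trans (proj₂ (inv b) ≤-refl)
                  (sym (relabel-no u l λ (c , lk , e) → none c (toℕ<n c) lk e))
        by (inj₂ (nz , m)) = _ , 2 , if-yes (λ z → nz (trans (sym here) z)) store , ≤-refl , λ v → upto v , beyond v
          where
          seven : reg τ 7 ≡ l u
          seven = trans (registers fr _ _) (label₇ sh)
          upto : ∀ v → toℕ v < suc (toℕ b) → update (arr τ 4) (reg τ 4) (reg τ 7) (toℕ v) ≡ relabel u l v
          upto v v≤b rewrite r₄ | seven with m≤n⇒m<n∨m≡n (≤-pred v≤b)
          ... | inj₁ v<b = trans (update-else (arr τ 4) (toℕ b) (l u) (≢-sym (<⇒≢ v<b))) (proj₁ (inv v) v<b)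
          ... | inj₂ v≡b rewrite toℕ-injective v≡b =
                  trans (update-here (arr τ 4) (toℕ b) (l u)) (sym (relabel-yes u l m))
          beyond : ∀ v → toℕ b < toℕ v → update (arr τ 4) (reg τ 4) (reg τ 7) (toℕ v) ≡ l v
          beyond v b<v rewrite r₄ = trans (update-else (arr τ 4) (toℕ b) (reg τ 7) (<⇒≢ b<v)) (proj₂ (inv v) (<⇒≤ b<v))
    ... | τ , t , p , t≤ , done = τ , t , p , t≤ , λ v → proj₁ (done v) (toℕ<n v)

    absorb-run : Runs absorb σ (1 + ((n * 3 + 2) + ((n * 4 + 2) + (n * 4 + 2))))
                   (λ τ → Labelled (relabel u l) τ × reg τ 5 ≡ toℕ u * n + n)
    absorb-run = runs-seq {K = 1} (runs-assign {Q = λ τ → τ ≡ setReg σ 7 (arr σ 4 (reg σ 3))} refl) λ { _ _ refl →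
        runs-seq (clear-run sh₀ labelled) λ τ p zeros →
        let sh₁ = finish (λ a a∈ → tt , separate D a∈ no₁₄ , tt) p _ _ _ _ sh₀
            lab₁ = λ v → trans (cong (λ g → g (toℕ v)) (arr-frame p _)) (labelled v)
        in runs-seq (mark-run sh₁ lab₁ (trans (reg-frame p _) r₅) zeros) λ υ q (marked , r₅′) →
        let (φ , t , p′ , t≤ , lab) = merge-run (finish (λ a a∈ → tt , (separate D a∈ no₁₄ , tt) , tt) q _ _ _ _ sh₁)
                (λ v → trans (cong (λ g → g (toℕ v)) (arr-frame q _)) (lab₁ v)) marked
        in φ , t , p′ , t≤ , lab , trans (reg-frame p′ _) r₅′ }
      where
      sh₀ : Shared (setReg σ 7 (arr σ 4 (reg σ 3)))
      sh₀ = record { still = known-frame known refl refl (λ _ _ → refl) ; centre₃ = r₃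
                   ; label₇ = trans (cong (arr σ 4) r₃) (labelled u) }

  components-phase : ∀ {D} → {T (elem 0 D)} → {T (elem 3 D)} → {T (not (elem 4 D))} → {T (not (elem 14 D))} →
    Phase D components 28 (4 ∷ D)
  components-phase {D} {has₀} {has₃} {no₄} {no₁₄} = phase λ {σ} known → absorbed known
    (runs-weaken bound
      (runs-seq (for-rule {n} 3 (put 4 (var 3) (var 3)) 1 (λ i τ → ∀ (v : Fin n) → toℕ v < i → arr τ 4 (toℕ v) ≡ toℕ v)
                   _ _ _ (order known) (initialise σ) (λ _ ())) λ τ p init →
       runs-seq {K = 1} (runs-assign {Q = λ υ → υ ≡ setReg τ 5 0} refl) λ { _ _ refl →
       for-rule {n} 3 absorb (1 + ((n * 3 + 2) + ((n * 4 + 2) + (n * 4 + 2))))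
         (λ i υ → Labelled (labels i) υ × reg υ 5 ≡ i * n) _ _ _ (trans (reg-frame p _) (order known))
         (merge τ (known-frame known (reg-frame p _) (reg-frame p _)
                     (λ a a∈ → arr-frame p (tt , separate D a∈ no₄ , tt))))
         ((λ v → init v (toℕ<n v)) , refl) }))
    where
    absorbed : ∀ {σ K} → Known D σ → Runs components σ K (λ τ → Labelled label τ × reg τ 5 ≡ n * n) →
               Runs components σ K (Known (4 ∷ D))
    absorbed known (τ , t , p , t≤ , lab , _) = τ , t , p , t≤ ,
      known-add (known-frame known (reg-frame p _) (reg-frame p _) λ a a∈ →
        let no4 = separate D a∈ no₄ ; no14 = separate D a∈ no₁₄
        in arr-frame p ((tt , no4 , tt) , tt , tt , (tt , (tt , no14 , tt) , (tt , (no14 , tt) , tt) , (tt , (no4 , tt) , tt)) , tt))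
        lab
    initialise : ∀ σ (u : Fin n) ρ → Frame (put 4 (var 3) (var 3)) 3 σ ρ → reg ρ 3 ≡ toℕ u →
      (∀ (v : Fin n) → toℕ v < toℕ u → arr ρ 4 (toℕ v) ≡ toℕ v) →
      Runs (put 4 (var 3) (var 3)) ρ 1 (λ τ → ∀ (v : Fin n) → toℕ v < suc (toℕ u) → arr τ 4 (toℕ v) ≡ toℕ v)
    initialise σ u ρ fr r₃ below = runs-store new
      where
      new : ∀ (v : Fin n) → toℕ v < suc (toℕ u) → update (arr ρ 4) (reg ρ 3) (reg ρ 3) (toℕ v) ≡ toℕ v
      new v v≤u rewrite r₃ with m≤n⇒m<n∨m≡n (≤-pred v≤u)
      ... | inj₁ v<u = trans (update-else (arr ρ 4) (toℕ u) (toℕ u) (≢-sym (<⇒≢ v<u))) (below v v<u)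
      ... | inj₂ v≡u rewrite v≡u = update-here (arr ρ 4) (toℕ u) (toℕ u)
    merge : ∀ τ → Known D τ → ∀ (u : Fin n) ρ → Frame absorb 3 (setReg τ 5 0) ρ → reg ρ 3 ≡ toℕ u →
      Labelled (labels (toℕ u)) ρ × reg ρ 5 ≡ toℕ u * n →
      Runs absorb ρ (1 + ((n * 3 + 2) + ((n * 4 + 2) + (n * 4 + 2))))
        (λ υ → Labelled (labels (suc (toℕ u))) υ × reg υ 5 ≡ suc (toℕ u) * n)
    merge τ known′ u ρ fr r₃ (lab , r₅) =
      let (υ , t , p , t≤ , lab′ , r₅′) = Absorb.absorb-run has₀ has₃ no₄ no₁₄ u (labels (toℕ u))
            (known-frame known′ (registers fr _ _) (registers fr _ _) λ a a∈ →
              let no4 = separate D a∈ no₄ ; no14 = separate D a∈ no₁₄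
              in arrays fr (tt , (tt , no14 , tt) , (tt , (no14 , tt) , tt) , (tt , (no4 , tt) , tt)))
            r₃ r₅ lab
      in υ , t , p , t≤ , (λ v → trans (lab′ v) (cong (λ l → l v) (sym (labels-suc u)))) ,
         trans r₅′ (+-comm (toℕ u * n) n)
    bound : n * 3 + 2 + (1 + (n * (1 + ((n * 3 + 2) + ((n * 4 + 2) + (n * 4 + 2))) + 2) + 2)) ≤ 28 * (n * n)
    bound = ≤-trans (≤-reflexive (eq n)) (quadratic 11 12 5)
      where
      eq : ∀ m → m * 3 + 2 + (1 + (m * (1 + ((m * 3 + 2) + ((m * 4 + 2) + (m * 4 + 2))) + 2) + 2)) ≡
                 11 * (m * m) + 12 * m + 5
      eq = solve-∀

  -- The whole program

  module _
    (M₁X-is : ∀ v → lookup M₁X v ≡ touchesᵇ ⁅ x ⁆ v ∧ not (touchesᵇ BY v) ∧ not (lookup BY v))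
    (M₁Y-is : ∀ v → lookup M₁Y v ≡ touchesᵇ BY v ∧ not (touchesᵇ ⁅ x ⁆ v) ∧ not (lookup ⁅ x ⁆ v))
    (M-is : ∀ v → lookup M v ≡ lookup M₁X v ∨ lookup M₁Y v)
    (W-is : ∀ v → lookup W v ≡
      (touchesᵇ M₁X v ∧ not (touchesᵇ ⁅ x ⁆ v) ∧ not (lookup ⁅ x ⁆ v)) ∨
      (touchesᵇ M₁Y v ∧ not (touchesᵇ BY v) ∧ not (lookup BY v)))
    (X-is : ∀ v → lookup ⁅ x ⁆ v ≡ (toℕ v ≡ᵇ toℕ x)) where

    set-phase : ∀ {D} out e (P : Subset n) (h : Fin n → Bool) → {T (not (elem out D))} →
      (∀ g → Bits P g → Spec out g) → (∀ v → lookup P v ≡ h v) →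
      (∀ u ρ → Known D ρ → reg ρ 3 ≡ toℕ u → Tests ρ e (h u)) → Phase D (pointwise out e) 6 (out ∷ D)
    set-phase out e P h {out∉} done P-is value = pointwise-phase out e (λ u → bit (lookup P u)) {out∉} done
      (λ u ρ k r₃ → trans (truth (value u ρ k r₃)) (cong bit (sym (P-is u))))

    count-phase : ∀ {D} out a (P : Subset n) → {T (not (elem out D))} → {T (elem 0 D)} →
      (∀ g → (∀ u → g (toℕ u) ≡ count P u) → Spec out g) →
      (∀ ρ → Known D ρ → Bits P (arr ρ a)) → Phase D (table out (neighbourIn a)) 13 (out ∷ D)
    count-phase out a P {out∉} {has₀} done bits = table-phase out (neighbourIn a)
      (λ u v → bit (lookup P v ∧ adj u v)) {out∉} done
      (λ u v ρ k _ r₄ r₅ → truth {ρ} {neighbourIn a} (∧-test (lookBit {P = P} (bits ρ k) r₄)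
        (tests (trans (cong (arr ρ 0) r₅) (spec k 0 {has₀} u v)))))

    -- The constant is 6 pointwise passes at 6, 7 tables at 13 and 28 for the components.
    preparation-phase : Phase (0 ∷ 1 ∷ []) preparation 155 finished
    preparation-phase =
      set-phase 7 (var 3 ==ₑ var 1) ⁅ x ⁆ _ (λ _ s → s) X-is
        (λ u ρ k r₃ → ==-test (yields r₃) (yields (centre k))) then
      count-phase 8 7 ⁅ x ⁆ (λ _ s → s) (λ ρ k → spec k 7) then
      count-phase 9 1 BY (λ _ s → s) (λ ρ k → spec k 1) then
      set-phase 10 m₁x M₁X _ (λ _ s → s) M₁X-is
        (λ u ρ k r₃ → ∧-test (pos-test (look (spec k 8) r₃))
          (∧-test (¬-test (pos-test (look (spec k 9) r₃))) (¬-test (lookBit {P = BY} (spec k 1) r₃)))) then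
      set-phase 11 m₁y M₁Y _ (λ _ s → s) M₁Y-is
        (λ u ρ k r₃ → ∧-test (pos-test (look (spec k 9) r₃))
          (∧-test (¬-test (pos-test (look (spec k 8) r₃))) (¬-test (lookBit {P = ⁅ x ⁆} (spec k 7) r₃)))) then
      set-phase 2 (atU 10 ∨ₑ atU 11) M _ (λ _ s → s) M-is
        (λ u ρ k r₃ → ∨-test (lookBit {P = M₁X} (spec k 10) r₃) (lookBit {P = M₁Y} (spec k 11) r₃)) then
      count-phase 12 10 M₁X (λ _ s → s) (λ ρ k → spec k 10) then
      count-phase 13 11 M₁Y (λ _ s → s) (λ ρ k → spec k 11) then
      set-phase 3 m₂ W _ (λ _ s → s) W-is
        (λ u ρ k r₃ → ∨-test
          (∧-test (pos-test (look (spec k 12) r₃))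
            (∧-test (¬-test (pos-test (look (spec k 8) r₃))) (¬-test (lookBit {P = ⁅ x ⁆} (spec k 7) r₃))))
          (∧-test (pos-test (look (spec k 13) r₃))
            (∧-test (¬-test (pos-test (look (spec k 9) r₃))) (¬-test (lookBit {P = BY} (spec k 1) r₃))))) then
      count-phase 5 2 M (λ _ s → s) (λ ρ k → spec k 2) then
      components-phase then
      table-phase 15 better (λ u v → bit (beats v u)) (λ _ s → s)
        (λ u v ρ k r₃ r₄ _ → truth {ρ} {better} (∧-test (lookBit {P = W} (spec k 3) r₄)
          (∧-test (==-test (look (spec k 4) r₄) (look (spec k 4) r₃))
            (∨-test (<-test (look (spec k 5) r₃) (look (spec k 5) r₄))
              (∧-test (==-test (look (spec k 5) r₃) (look (spec k 5) r₄)) (<-test (yields r₄) (yields r₃))))))) then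
      set-phase 6 selected S _ (λ _ s → s) (lookup∘tabulate _)
        (λ u ρ k r₃ → ∧-test (lookBit {P = W} (spec k 3) r₃) (¬-test (pos-test (look (spec k 15) r₃)))) then
      count-phase 16 6 S (λ _ s → s) (λ ρ k → spec k 6)

    program-runs : ∀ {σ} → Known (0 ∷ 1 ∷ []) σ → Runs program σ (163 * (n * n))
      (λ τ → Known finished τ ×
             reg τ 2 ≡ 1 ∸ total (λ v → bit (missed v)))
    program-runs {σ} known = runs-weaken (≤-trans (+-monoʳ-≤ (155 * (n * n)) bound)
        (≤-reflexive (sym (*-distribʳ-+ (n * n) 155 8))))
      (runs-seq (run preparation-phase known) λ τ _ k →
       runs-seq {L = 1} (sum-rule undominated (λ v → bit (missed v)) k
         λ v ρ k′ _ r₄ _ → truth {ρ} {undominated} (∧-test (lookBit {P = M} (spec k′ 2) r₄)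
           (∧-test (¬-test (lookBit {P = S} (spec k′ 6) r₄)) (¬-test (pos-test (look (spec k′ 16) r₄))))))
       λ υ p (s≡ , _) → runs-assign
         ( known-frame k (reg-frame p _) (reg-frame p _) (λ a _ → arr-frame p _)
         , cong (1 ∸_) s≡))
      where
      bound : 1 + (n * 4 + 2) + 1 ≤ 8 * (n * n)
      bound = ≤-trans (≤-reflexive (eq n)) (quadratic 0 4 4)
        where
        eq : ∀ m → 1 + (m * 4 + 2) + 1 ≡ 4 * m + 4
        eq = solve-∀

-- Correctness of the output

transport : ∀ {A B : Set} {b} → A ⇔ B → Reflects A b → Reflects B b
transport e (ofʸ a)  = ofʸ (Equivalence.to e a)
transport e (ofⁿ ¬a) = ofⁿ (¬a ∘ Equivalence.from e)

∈-reflects : ∀ {n} (P : Subset n) v → Reflects (v ∈ P) (lookup P v)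
∈-reflects P v = fromEquivalence
  (λ t → lookup⇒[]= v P (Equivalence.to T-≡ t)) (λ v∈ → Equivalence.from T-≡ ([]=⇒lookup v∈))

-- Booleans reflecting the same proposition coincide. This turns membership criteria into the
-- equations that the execution asks for.
lookup-member : ∀ {n} {P : Subset n} {v} {A : Set} {b} → v ∈ P ⇔ A → Reflects A b → lookup P v ≡ b
lookup-member {P = P} {v} e r = det (transport e (∈-reflects P v)) r

total-cong : ∀ {n} {g h : Fin n → ℕ} → (∀ v → g v ≡ h v) → total g ≡ total h
total-cong {zero}  e = refl
total-cong {suc n} e = cong₂ _+_ (e Fin.zero) (total-cong (e ∘ Fin.suc))

total-size : ∀ {n} (P : Subset n) → total (λ v → bit (lookup P v)) ≡ ∣ P ∣
total-size []          = refl
total-size (true ∷ P)  = cong suc (total-size P)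
total-size (false ∷ P) = total-size P

total-reflects : ∀ {n} {P : Fin n → Set} {b : Fin n → Bool} → (∀ v → Reflects (P v) (b v)) →
                 Reflects (∃[ v ] P v) (0 <ᵇ total (λ v → bit (b v)))
total-reflects {zero} r = ofⁿ λ ()
total-reflects {suc n} {P} {b} r with b Fin.zero | r Fin.zero
... | true  | ofʸ p  = ofʸ (Fin.zero , p)
... | false | ofⁿ ¬p with total-reflects {P = P ∘ Fin.suc} (r ∘ Fin.suc)
...   | rest = transport (mk⇔ (λ (v , p) → Fin.suc v , p)
                 λ { (Fin.zero , p) → contradiction p ¬p ; (Fin.suc v , p) → v , p }) rest

1∸-reflects : ∀ {A : Set} k → Reflects A (0 <ᵇ k) → (¬ A → 1 ∸ k ≡ 1) × (A → 1 ∸ k ≡ 0)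
1∸-reflects zero    (ofⁿ ¬a) = (λ _ → refl) , λ a → contradiction a ¬a
1∸-reflects (suc k) (ofʸ a)  = (λ ¬a → contradiction a ¬a) , λ _ → 0∸n≡0 k

≡ᵇ-reflects : ∀ a b → Reflects (a ≡ b) (a ≡ᵇ b)
≡ᵇ-reflects a b = fromEquivalence (≡ᵇ⇒≡ a b) (≡⇒≡ᵇ a b)

module Correctness {n : ℕ} (G : Graph n) (x : Fin n) (BY M₁X M₁Y M₂X M₂Y : Subset n)
  (∈M₁X : ∀ {v} → v ∈ M₁X ⇔ (Touches G ⁅ x ⁆ v × ¬ Touches G BY v × v ∉ BY))
  (∈M₁Y : ∀ {v} → v ∈ M₁Y ⇔ (Touches G BY v × ¬ Touches G ⁅ x ⁆ v × v ∉ ⁅ x ⁆))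
  (∈M₂X : ∀ {w} → w ∈ M₂X ⇔ (Touches G M₁X w × ¬ Touches G ⁅ x ⁆ w × w ∉ ⁅ x ⁆))
  (∈M₂Y : ∀ {w} → w ∈ M₂Y ⇔ (Touches G M₁Y w × ¬ Touches G BY w × w ∉ BY))
  (F : Fin n → Subset n) (∈F : ∀ {v w} → v ∈ F w ⇔ (v ∈ M₁X ∪ M₁Y × Graph.Adj G v w)) where
  open Graph G

  M W : Subset n
  M = M₁X ∪ M₁Y
  W = M₂X ∪ M₂Y

  open Labelling G W
  open Execution G x BY M₁X M₁Y M W

  touches-reflects : ∀ P v → Reflects (Touches G P v) (touchesᵇ P v)
  touches-reflects P v = total-reflects λ s → ∈-reflects P s ×-reflects T-reflects (adj v s)

  no-touches-reflects : ∀ P Q v → Reflects (Touches G Q v × ¬ Touches G P v × v ∉ P)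
                        (touchesᵇ Q v ∧ not (touchesᵇ P v) ∧ not (lookup P v))
  no-touches-reflects P Q v = touches-reflects Q v ×-reflects
    ¬-reflects (touches-reflects P v) ×-reflects ¬-reflects (∈-reflects P v)

  runs : ∀ {σ} → Known (0 ∷ 1 ∷ []) σ → Runs program σ (163 * (n * n)) (λ τ → Known finished τ × reg τ 2 ≡ 1 ∸ total (λ v → bit (missed v)))
  runs = program-runs
    (λ v → lookup-member ∈M₁X (no-touches-reflects BY ⁅ x ⁆ v))
    (λ v → lookup-member ∈M₁Y (no-touches-reflects ⁅ x ⁆ BY v))
    (λ v → lookup-member (∪⇔⊎ {p = M₁X} {q = M₁Y}) (∈-reflects M₁X v ⊎-reflects ∈-reflects M₁Y v))
    (λ v → lookup-member (∪⇔⊎ {p = M₂X} {q = M₂Y})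
      (transport (⇔-sym ∈M₂X) (no-touches-reflects ⁅ x ⁆ M₁X v) ⊎-reflects
       transport (⇔-sym ∈M₂Y) (no-touches-reflects BY M₁Y v)))
    (λ v → lookup-member x∈⁅y⁆⇔x≡y (transport (mk⇔ toℕ-injective (cong toℕ)) (≡ᵇ-reflects (toℕ v) (toℕ x))))
    where
    ⇔-sym : ∀ {A B : Set} → A ⇔ B → B ⇔ A
    ⇔-sym e = mk⇔ (Equivalence.from e) (Equivalence.to e)

  count-is : ∀ w → count M w ≡ ∣ F w ∣
  count-is w = trans (total-cong λ v → cong bit (sym (lookup-member ∈F
      (∈-reflects M v ×-reflects transport (mk⇔ (symmetric G) (symmetric G)) (T-reflects (adj w v))))))
    (total-size (F w))

  -- The chosen vertices

  Beats : Fin n → Fin n → Set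
  Beats v u = v ∈ W × label v ≡ label u × (count M u < count M v ⊎ (count M u ≡ count M v × toℕ v < toℕ u))

  beats-reflects : ∀ v u → Reflects (Beats v u) (beats v u)
  beats-reflects v u = ∈-reflects W v ×-reflects ≡ᵇ-reflects (label v) (label u) ×-reflects
    (<ᵇ-reflects-< (count M u) (count M v) ⊎-reflects
     (≡ᵇ-reflects (count M u) (count M v) ×-reflects <ᵇ-reflects-< (toℕ v) (toℕ u)))

  S-reflects : ∀ u → Reflects (u ∈ W × ¬ (∃[ v ] Beats v u)) (lookup S u)
  S-reflects u = subst (Reflects _) (sym (lookup∘tabulate _ u))
    (∈-reflects W u ×-reflects ¬-reflects (total-reflects λ v → beats-reflects v u))

  ∈S : ∀ {u} → u ∈ S ⇔ (u ∈ W × ¬ (∃[ v ] Beats v u))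
  ∈S {u} = mk⇔ (λ u∈ → yes-of (∈-reflects S u) (S-reflects u) u∈) (λ p → yes-of (S-reflects u) (∈-reflects S u) p)
    where
    yes-of : ∀ {A B : Set} {b} → Reflects A b → Reflects B b → A → B
    yes-of (ofʸ _)  (ofʸ b) _ = b
    yes-of (ofⁿ ¬a) _       a = contradiction a ¬a

  Best : Subset n → Fin n → Fin n → Set
  Best C u v = count M v ≤ count M u × (count M v ≡ count M u → toℕ u ≤ toℕ v)

  bestBelow : ∀ C i → (∀ v → toℕ v < i → v ∉ C) ⊎
    (∃[ u ] u ∈ C × toℕ u < i × (∀ v → v ∈ C → toℕ v < i → Best C u v))
  bestBelow C zero = inj₁ λ _ ()
  bestBelow C (suc i) with i <? n
  bestBelow C (suc i) | no i≮n = [ (λ none → inj₁ λ v _ → none v (<-≤-trans (toℕ<n v) (≮⇒≥ i≮n)))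
      , (λ (u , u∈ , u<i , best) → inj₂ (u , u∈ , m<n⇒m<1+n u<i ,
           λ v v∈ _ → best v v∈ (<-≤-trans (toℕ<n v) (≮⇒≥ i≮n)))) ]′ (bestBelow C i)
  bestBelow C (suc i) | yes i<n with fromℕ< i<n | toℕ-fromℕ< i<n
  ... | z | refl with z ∈? C | bestBelow C (toℕ z)
  ...   | no z∉ | inj₁ none = inj₁ λ v v≤z v∈ → case m≤n⇒m<n∨m≡n (≤-pred v≤z) of λ where
            (inj₁ v<z) → none v v<z v∈
            (inj₂ v≡z) → z∉ (subst (_∈ C) (toℕ-injective v≡z) v∈)
  ...   | no z∉ | inj₂ (u , u∈ , u<z , best) = inj₂ (u , u∈ , m<n⇒m<1+n u<z , λ v v∈ v≤z →
            case m≤n⇒m<n∨m≡n (≤-pred v≤z) of λ where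
              (inj₁ v<z) → best v v∈ v<z
              (inj₂ v≡z) → contradiction (subst (_∈ C) (toℕ-injective v≡z) v∈) z∉)
  ...   | yes z∈ | inj₁ none = inj₂ (z , z∈ , ≤-refl , λ v v∈ v≤z → case m≤n⇒m<n∨m≡n (≤-pred v≤z) of λ where
            (inj₁ v<z) → contradiction v∈ (none v v<z)
            (inj₂ v≡z) → subst (Best C z) (toℕ-injective (sym v≡z)) (≤-refl , λ _ → ≤-refl))
  -- The newcomer `z` has the larger index, so it replaces `u` only if its count is strictly larger.
  ...   | yes z∈ | inj₂ (u , u∈ , u<z , best) with count M u <? count M z
  ...     | yes u<′z = inj₂ (z , z∈ , ≤-refl , λ v v∈ v≤z → case m≤n⇒m<n∨m≡n (≤-pred v≤z) of λ where
              (inj₁ v<z) → let v<′z = ≤-<-trans (proj₁ (best v v∈ v<z)) u<′z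
                           in <⇒≤ v<′z , λ e → contradiction e (<⇒≢ v<′z)
              (inj₂ v≡z) → subst (Best C z) (toℕ-injective (sym v≡z)) (≤-refl , λ _ → ≤-refl))
  ...     | no u≮′z = inj₂ (u , u∈ , m<n⇒m<1+n u<z , λ v v∈ v≤z → case m≤n⇒m<n∨m≡n (≤-pred v≤z) of λ where
              (inj₁ v<z) → best v v∈ v<z
              (inj₂ v≡z) → subst (Best C u) (toℕ-injective (sym v≡z)) (≮⇒≥ u≮′z , λ _ → <⇒≤ u<z))

  module _ {C : Subset n} (isC : IsComponent G W C) where
    open IsComponent isC

    same-label : ∀ {u v} → u ∈ C → v ∈ C → label u ≡ label v
    same-label u∈ v∈ = label-reachable (connected u∈ v∈)

    unbeaten-best : ∀ {u v} → u ∈ C → u ∈ S → v ∈ C → Best C u v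
    unbeaten-best {u} {v} u∈C u∈S v∈C =
      ≮⇒≥ (λ u<v → unbeaten (v , contained v∈C , same-label v∈C u∈C , inj₁ u<v)) ,
      λ e → ≮⇒≥ (λ v<u → unbeaten (v , contained v∈C , same-label v∈C u∈C , inj₂ (sym e , v<u)))
      where
      unbeaten : ¬ (∃[ v ] Beats v u)
      unbeaten = proj₂ (Equivalence.to ∈S u∈S)

    unbeaten-exists : ∃[ u ] u ∈ C × u ∈ S
    unbeaten-exists with bestBelow C n
    ... | inj₁ none = contradiction (proj₂ nonempty) (none _ (toℕ<n _))
    -- A vertex beating `u` carries the label of `u`, so by soundness of the labels it lies in `C`,
    -- where `u` is best.
    ... | inj₂ (u , u∈ , _ , best) = u , u∈ , Equivalence.from ∈S (contained u∈ , λ (v , v∈ , e , better) →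
        let (v≤u , first) = best v (closed u∈ (labels-sound n (contained u∈) v∈ (sym e))) (toℕ<n v)
        in [ (λ u<v → <⇒≱ u<v v≤u) , (λ (e′ , v<u) → <⇒≱ v<u (first (sym e′))) ]′ better)

    unbeaten-unique : ∀ {u v} → u ∈ C → u ∈ S → v ∈ C → v ∈ S → u ≡ v
    unbeaten-unique u∈C u∈S v∈C v∈S =
      let (v≤u , f) = unbeaten-best u∈C u∈S v∈C ; (u≤v , g) = unbeaten-best v∈C v∈S u∈C
          e = ≤-antisym v≤u u≤v
      in toℕ-injective (≤-antisym (f e) (g (sym e)))

  unbeaten? : ∀ C → Dec (∃[ u ] u ∈ C × u ∈ S)
  unbeaten? C = any? λ u → (u ∈? C) ×-dec (u ∈? S)

  choose : Subset n → Fin n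
  choose C with unbeaten? C
  ... | yes (u , _) = u
  -- A default for sets that contain no vertex of `S`; components never get here.
  ... | no _        = x

  choose-spec : ∀ C → IsComponent G W C → choose C ∈ C × choose C ∈ S
  choose-spec C isC with unbeaten? C
  ... | yes (u , p) = p
  ... | no ¬p       = contradiction (unbeaten-exists isC) ¬p

  chosen : ∀ C → IsComponent G W C → choose C ∈ C
  chosen C isC = proj₁ (choose-spec C isC)

  maximal : ∀ C → IsComponent G W C → ∀ v → v ∈ C → ∣ F v ∣ ≤ ∣ F (choose C) ∣
  maximal C isC v v∈ = subst₂ _≤_ (count-is v) (count-is (choose C))
    (let (c∈ , s∈) = choose-spec C isC in proj₁ (unbeaten-best isC c∈ s∈ v∈))

  image : ∀ v → v ∈ S ⇔ (∃[ C ] IsComponent G W C × v ≡ choose C)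
  image v = mk⇔
    (λ v∈S → let v∈W = proj₁ (Equivalence.to ∈S v∈S)
                 isC = component-is v∈W
                 (c∈ , s∈) = choose-spec (component v) isC
             in component v , isC , unbeaten-unique isC (∈-component v∈W refl) v∈S c∈ s∈)
    (λ (C , isC , e) → subst (_∈ S) (sym e) (proj₂ (choose-spec C isC)))

  components-are : ∀ u v → u ∈ W → v ∈ W → label u ≡ label v ⇔ (∃[ C ] IsComponent G W C × u ∈ C × v ∈ C)
  components-are u v u∈ v∈ = mk⇔
    (λ e → component u , component-is u∈ , ∈-component u∈ refl , ∈-component v∈ e)
    (λ (C , isC , u∈C , v∈C) → same-label isC u∈C v∈C)

  missed-reflects : Reflects (∃[ v ] v ∈ M × v ∉ S × ¬ Touches G S v) (0 <ᵇ total (λ v → bit (missed v)))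
  missed-reflects = total-reflects λ v →
    ∈-reflects M v ×-reflects ¬-reflects (∈-reflects S v) ×-reflects ¬-reflects (touches-reflects S v)

  answer : ℕ
  answer = 1 ∸ total (λ v → bit (missed v))

  answer-yes : Dominates G S M → answer ≡ 1
  answer-yes dom = proj₁ (1∸-reflects (total λ v → bit (missed v)) missed-reflects) λ (v , v∈ , v∉S , ¬t) →
    [ v∉S , ¬t ]′ (∈N≤1⁻ G (dom v∈))

  answer-no : ¬ Dominates G S M → answer ≡ 0
  answer-no ¬dom with total (λ v → bit (missed v)) | missed-reflects
  ... | suc k | ofʸ _  = 0∸n≡0 k
  ... | zero  | ofⁿ ¬m = contradiction (λ {v} v∈ → ∈N≤1⁺ G (near v v∈)) ¬dom
    where
    near : ∀ v → v ∈ M → v ∈ S ⊎ Touches G S v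
    near v v∈ with v ∈? S | touches? G S v
    ... | yes v∈S | _     = inj₁ v∈S
    ... | no _    | yes t = inj₂ t
    ... | no v∉S  | no ¬t = contradiction (v , v∈ , v∉S , ¬t) ¬m

-- Instantiation with M₁(B), M₂(B) and `f`

module _ {n : ℕ} (G : Graph n) {x : Fin n} {BY : Subset n} (B : InducedCompleteBipartite G ⁅ x ⁆ BY) where
  private
    module X = Characterisation G (swapSides B)
    module Y = Characterisation G B
  open Correctness G x BY (M₁-of G BY ⁅ x ⁆) (M₁-of G ⁅ x ⁆ BY) (M₂-of G BY ⁅ x ⁆ ⁅ x ⁆) (M₂-of G ⁅ x ⁆ BY BY)
    X.∈M₁-of Y.∈M₁-of X.∈M₂-of Y.∈M₂-of (f G ⁅ x ⁆ BY) (Paper.∈f G B)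
  open Execution G x BY (M₁-of G BY ⁅ x ⁆) (M₁-of G ⁅ x ⁆ BY) M W

  program-correct : ∀ {σ} → Input G x BY σ →
    ∃[ τ ] ∃[ t ] (program ⊢ σ ⇓ τ [ t ]) × t ≤ 163 * (n * n) × Output G ⁅ x ⁆ BY τ
  program-correct {σ} input =
    let (τ , t , p , t≤ , k , a) = runs (record { order = Input.order input ; centre = Input.centre input ; spec = initial })
    in τ , t , p , t≤ , record
      { M₁-array   = spec k 2
      ; M₂-array   = spec k 3
      ; components = λ u v u∈ v∈ → subst₂ (λ i j → i ≡ j ⇔ _) (sym (spec k 4 u)) (sym (spec k 4 v))
                       (components-are u v u∈ v∈)
      ; f-sizes    = λ w _ → trans (spec k 5 w) (count-is w)
      ; w          = choose
      ; S          = S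
      ; S-chosen   = record { chosen = chosen ; maximal = maximal ; image = image }
      ; S-array    = spec k 6
      ; answer-yes = λ dom → trans a (answer-yes dom)
      ; answer-no  = λ ¬dom → trans a (answer-no ¬dom) }
    where
    initial : ∀ a {_ : T (elem a (0 ∷ 1 ∷ []))} → Spec a (arr σ a)
    initial 0 = Input.matrix input
    initial 1 = Input.leaves input

mainTheorem2 : (∀ {n : ℕ} (G : Graph n) → Chordal G →
    ∀ (x : Fin n) (BY : Subset n) → InducedCompleteBipartite G ⁅ x ⁆ BY →
    ∀ (w : Subset n → Fin n) (S : Subset n) → ChosenBy G ⁅ x ⁆ BY w S →
    Generating G ⁅ x ⁆ BY ⇔ Dominates G S (M₁ G ⁅ x ⁆ BY))
    × (∃[ c ] RunsInQuadraticTime c)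
mainTheorem2 =
  (λ G chordal x BY B w S choice → Paper.generating⇔dominates G B chordal choice) ,
  program , 163 , λ G _ x BY B σ input → program-correct G B input
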